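{- Let $b>1$ be a rational number and $d\in\{ -163,-67,-43,-19,-11,-7,-3,-2,-1\}$. Let $U(b)=\{n\in\mathbb{N}:\sigma^*(n)=bn\}$ and $V_d(b)=\{z\in A(d): I_1^*(z)=b\}$, where $I_1^*$ is computed in $\mathcal O_{\mathbb{Q}(\sqrt{d})}$. Then there exists an injective function $g:U(b)\to V_d(b)$.
   Context: For a positive integer $n$, $\sigma^*(n)$ is the sum of the unitary divisors of $n$, i.e. of the positive divisors $c$ of $n$ with $\gcd(c,n/c)=1$. $\mathcal O_{\mathbb{Q}(\sqrt{d})}$ is $\mathbb{Z}[\frac{1+\sqrt d}{2}]$ if $d\equiv 1 \pmod 4$ and $\mathbb{Z}[\sqrt d]$ if $d\equiv 2,3\pmod 4$; for the listed $d$ it is a unique factorization domain. $|z|=\sqrt{z\bar z}$, $\arg(z)\in[0,2\pi)$. $A(d)$ is the set of nonzero $z\in\mathcal O_{\mathbb{Q}(\sqrt{d})}$ with $0\le\arg(z)<\pi/2$ if $d=-1$, with $0\le \arg(z)<\pi/3$ if $d=-3$, and with $0\le\arg(z)<\pi$ otherwise. Two elements are relatively prime if they have no nonunit common divisor. For nonzero $x,z$, write $x\Diamond z$ iff $x\in A(d)$, $x\mid z$, and $x$ is relatively prime to $z/x$. Define $\delta_1^*(z)=\sum_{x\Diamond z}|x|$ and $I_1^*(z)=\delta_1^*(z)/|z|$. -}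

module Defs where

open import Algebra.Bundles using (CommutativeRing; RawSemiring)
open import Algebra.Structures using (IsCommutativeRing)
import Algebra.Definitions.RawMagma as RawMagmaDefinitions
import Algebra.Definitions.RawSemiring as RawSemiringDefinitions
open import Data.Integer.Base as ℤ using (ℤ; +_; -[1+_]; 0ℤ; 1ℤ)
import Data.Integer.DivMod as ℤ
import Data.Integer.Properties as ℤ
import Data.Integer.Solver as ℤ-Solver
open import Data.List.Base using (List; []; _∷_; _++_; map; filter; foldr; upTo; cartesianProductWith)
open import Data.List.Membership.Propositional using (_∈_; lose; find)
import Data.List.Membership.Propositional.Properties as ∈
open import Data.List.Relation.Unary.All as All using (All; []; _∷_)
open import Data.List.Relation.Unary.Any using (any?)
open import Data.List.Relation.Unary.Unique.Propositional using (Unique)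
import Data.List.Relation.Unary.Unique.Propositional.Properties as Unique
open import Data.Nat.Base as ℕ using (ℕ; zero; suc)
open import Data.Nat.ListAction using (sum)
import Data.Nat.Divisibility as ℕ
import Data.Nat.DivMod as ℕ
import Data.Nat.GCD as ℕ
import Data.Nat.Properties as ℕ
open import Data.Product.Base using (∃; Σ; _×_; _,_; proj₁; proj₂)
open import Data.Rational.Base as ℚ using (ℚ)
open import Data.Refinement using (Refinement; Refinement-syntax)
open import Data.Sum.Base using (_⊎_; inj₁; inj₂)
open import Function.Base using (_∘_)
open import Function.Bundles using (_⇔_; mk⇔)
open import Relation.Binary.Definitions using (Decidable; DecidableEquality)
open import Relation.Binary.PropositionalEquality
  using (_≡_; _≢_; refl; sym; trans; cong; cong₂; subst; subst₂; isEquivalence)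
open import Relation.Nullary.Decidable using (Dec; yes; no; map′; ¬?; _×-dec_; _⊎-dec_; decidable-stable)
open import Relation.Nullary.Negation using (¬_; contradiction)

-- The library has no real numbers; they are built here as Cauchy sequences of
-- rationals.  Equality of reals is _≃_, not _≡_.

module Real where
  open import Data.Rational.Base hiding (_≃_)
  open import Data.Rational.Properties
  open import Data.Rational.Solver using (module +-*-Solver)
  import Data.Rational.Unnormalised.Base as ℚᵘ
  import Data.Rational.Unnormalised.Properties as ℚᵘ

  IsCauchy : (ℕ → ℚ) → Set
  IsCauchy x = ∀ ε → 0ℚ < ε →
    ∃ λ N → ∀ m n → N ℕ.≤ m → N ℕ.≤ n → ∣ x m - x n ∣ < ε

  record ℝ : Set where
    constructor mkℝ
    field
      seq    : ℕ → ℚ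
      cauchy : IsCauchy seq
  open ℝ public

  infix 4 _≃_
  _≃_ : ℝ → ℝ → Set
  x ≃ y = ∀ ε → 0ℚ < ε →
    ∃ λ N → ∀ n → N ℕ.≤ n → ∣ seq x n - seq y n ∣ < ε

  Eventually>0 : (ℕ → ℚ) → Set
  Eventually>0 x = ∃ λ ε → 0ℚ < ε × ∃ λ N → ∀ n → N ℕ.≤ n → ε ≤ x n

  infix 4 0<_
  0<_ : ℝ → Set
  0< x = Eventually>0 (seq x)

  -- The value at 0 does not matter: only eventually positive sequences are inverted.
  inv₀ : ℚ → ℚ
  inv₀ p with p ≟ 0ℚ
  ... | yes _   = 0ℚ
  ... | no  p≢0 = 1/_ p {{≢-nonZero p≢0}}

  isqrt : ℕ → ℕ
  isqrt zero    = zero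
  isqrt (suc n) with suc (isqrt n) ℕ.* suc (isqrt n) ℕ.≤? suc n
  ... | yes _ = suc (isqrt n)
  ... | no  _ = isqrt n

  √-seq : ℕ → ℕ → ℚ
  √-seq m k = + isqrt (m ℕ.* (suc k ℕ.* suc k)) / suc k

  private
    half : ∀ ε → 0ℚ < ε → 0ℚ < ½ * ε
    half ε p = subst (_< ½ * ε) (*-zeroʳ ½) (*-monoʳ-<-pos ½ p)

    half+half : ∀ ε → ½ * ε + ½ * ε ≡ ε
    half+half = solve 1 (λ ε → con ½ :* ε :+ con ½ :* ε := ε) refl
      where open +-*-Solver

    0≤∣⇒0≤ : ∀ {p q} → ∣ p ∣ < q → 0ℚ < q
    0≤∣⇒0≤ {p} h = ≤-<-trans (0≤∣p∣ p) h

    ∣-∣< : ∀ {p ε} → p < ε → - p < ε → ∣ p ∣ < ε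
    ∣-∣< {p} a b with ∣p∣≡p∨∣p∣≡-p p
    ... | inj₁ e = subst (_< _) (sym e) a
    ... | inj₂ e = subst (_< _) (sym e) b

    p<q+r⇒p-q<r : ∀ {p q r} → p < q + r → p - q < r
    p<q+r⇒p-q<r {p} {q} {r} h =
      subst (p - q <_) (solve 2 (λ q r → q :+ r :- q := r) refl q r) (+-monoˡ-< (- q) h)
      where open +-*-Solver

    const-cauchy : ∀ p → IsCauchy (λ _ → p)
    const-cauchy p ε 0<ε = 0 , λ _ _ _ _ →
      subst (_< ε) (sym (cong ∣_∣ (+-inverseʳ p))) 0<ε

    +-cauchy : ∀ x y → IsCauchy x → IsCauchy y → IsCauchy (λ n → x n + y n)
    +-cauchy x y cx cy ε 0<ε with cx (½ * ε) (half ε 0<ε) | cy (½ * ε) (half ε 0<ε)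
    ... | N , p | M , q = N ℕ.⊔ M , λ m n m≥ n≥ → begin-strict
      ∣ (x m + y m) - (x n + y n) ∣
        ≡⟨ cong ∣_∣ (solve 4 (λ a b c d → (a :+ b) :- (c :+ d) := (a :- c) :+ (b :- d)) refl (x m) (y m) (x n) (y n)) ⟩
      ∣ (x m - x n) + (y m - y n) ∣  ≤⟨ ∣p+q∣≤∣p∣+∣q∣ (x m - x n) (y m - y n) ⟩
      ∣ x m - x n ∣ + ∣ y m - y n ∣
        <⟨ +-mono-< (p m n (ℕ.m⊔n≤o⇒m≤o N M m≥) (ℕ.m⊔n≤o⇒m≤o N M n≥))
                    (q m n (ℕ.m⊔n≤o⇒n≤o N M m≥) (ℕ.m⊔n≤o⇒n≤o N M n≥)) ⟩
      ½ * ε + ½ * ε  ≡⟨ half+half ε ⟩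
      ε ∎
      where open ≤-Reasoning
            open +-*-Solver

    eventuallyBounded : ∀ x → IsCauchy x →
      ∃ λ B → 0ℚ < B × ∃ λ N → ∀ n → N ℕ.≤ n → ∣ x n ∣ < B
    eventuallyBounded x cx with cx 1ℚ (positive⁻¹ 1ℚ)
    ... | N , p = ∣ x N ∣ + 1ℚ , 0≤∣⇒0≤ {x N} (bd N ℕ.≤-refl) , N , bd
      where
      open +-*-Solver
      open ≤-Reasoning
      bd : ∀ n → N ℕ.≤ n → ∣ x n ∣ < ∣ x N ∣ + 1ℚ
      bd n n≥ = begin-strict
        ∣ x n ∣ ≡⟨ cong ∣_∣ (solve 2 (λ a b → a := b :+ (a :- b)) refl (x n) (x N)) ⟩
        ∣ x N + (x n - x N) ∣ ≤⟨ ∣p+q∣≤∣p∣+∣q∣ (x N) (x n - x N) ⟩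
        ∣ x N ∣ + ∣ x n - x N ∣ <⟨ +-monoʳ-< ∣ x N ∣ (p n N n≥ ℕ.≤-refl) ⟩
        ∣ x N ∣ + 1ℚ ∎

    split : ∀ ε B → 0ℚ < ε → 0ℚ < B → ∃ λ η → 0ℚ < η × B * η + B * η ≡ ε
    split ε B 0<ε 0<B = ½ * (ε * B⁻¹) , half _ 0<η ,
      trans (solve 3 (λ b e i → b :* (con ½ :* (e :* i)) :+ b :* (con ½ :* (e :* i)) := e :* (b :* i)) refl B ε B⁻¹)
            (trans (cong (ε *_) (*-inverseʳ B)) (*-identityʳ ε))
      where
      open +-*-Solver
      instance
        B+ : Positive B
        B+ = positive 0<B
        B≠ : NonZero B
        B≠ = pos⇒nonZero B
        ε+ : Positive ε
        ε+ = positive 0<ε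
      B⁻¹ = 1/ B
      instance
        B⁻¹+ : Positive B⁻¹
        B⁻¹+ = 1/pos⇒pos B
      0<η : 0ℚ < ε * B⁻¹
      0<η = positive⁻¹ (ε * B⁻¹) {{pos*pos⇒pos ε B⁻¹}}

    ∣*∣≤ : ∀ B p q → 0ℚ < B → ∣ p ∣ < B → ∣ p * q ∣ ≤ B * ∣ q ∣
    ∣*∣≤ B p q 0<B p<B = subst (_≤ B * ∣ q ∣) (sym (∣p*q∣≡∣p∣*∣q∣ p q))
      (*-monoʳ-≤-nonNeg ∣ q ∣ {{∣-∣-nonNeg q}} (<⇒≤ p<B))

    ∣*-*∣< : ∀ B η ε a b c d → 0ℚ < B → B * η + B * η ≡ ε →
      ∣ a ∣ < B → ∣ d ∣ < B → ∣ b - d ∣ < η → ∣ a - c ∣ < η → ∣ a * b - c * d ∣ < ε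
    ∣*-*∣< B η ε a b c d 0<B eq a<B d<B bd ac = begin-strict
      ∣ a * b - c * d ∣
        ≡⟨ cong ∣_∣ (solve 4 (λ a b c d → a :* b :- c :* d := a :* (b :- d) :+ d :* (a :- c)) refl a b c d) ⟩
      ∣ a * (b - d) + d * (a - c) ∣
        ≤⟨ ∣p+q∣≤∣p∣+∣q∣ (a * (b - d)) (d * (a - c)) ⟩
      ∣ a * (b - d) ∣ + ∣ d * (a - c) ∣
        ≤⟨ +-mono-≤ (∣*∣≤ B a (b - d) 0<B a<B) (∣*∣≤ B d (a - c) 0<B d<B) ⟩
      B * ∣ b - d ∣ + B * ∣ a - c ∣
        <⟨ +-mono-< (*-monoʳ-<-pos B {{positive 0<B}} bd) (*-monoʳ-<-pos B {{positive 0<B}} ac) ⟩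
      B * η + B * η ≡⟨ eq ⟩
      ε ∎
      where
      open ≤-Reasoning
      open +-*-Solver

    *-cauchy : ∀ x y → IsCauchy x → IsCauchy y → IsCauchy (λ n → x n * y n)
    *-cauchy x y cx cy ε 0<ε =
      let B₁ , 0<B₁ , N₁ , b₁ = eventuallyBounded x cx
          B₂ , 0<B₂ , N₂ , b₂ = eventuallyBounded y cy
          0<B = +-mono-< 0<B₁ 0<B₂
          η , 0<η , eq = split ε (B₁ + B₂) 0<ε 0<B
          N₃ , p = cx η 0<η
          N₄ , q = cy η 0<η
          N₁₂ = N₁ ℕ.⊔ N₂
          N₃₄ = N₃ ℕ.⊔ N₄
      in N₁₂ ℕ.⊔ N₃₄ , λ m n m≥ n≥ →
      ∣*-*∣< (B₁ + B₂) η ε (x m) (y m) (x n) (y n) 0<B eq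
        (subst (_< B₁ + B₂) (+-identityʳ ∣ x m ∣)
          (+-mono-< (b₁ m (ℕ.m⊔n≤o⇒m≤o N₁ N₂ (ℕ.m⊔n≤o⇒m≤o N₁₂ N₃₄ m≥))) 0<B₂))
        (subst (_< B₁ + B₂) (+-identityˡ ∣ y n ∣)
          (+-mono-< 0<B₁ (b₂ n (ℕ.m⊔n≤o⇒n≤o N₁ N₂ (ℕ.m⊔n≤o⇒m≤o N₁₂ N₃₄ n≥)))))
        (q m n (ℕ.m⊔n≤o⇒n≤o N₃ N₄ (ℕ.m⊔n≤o⇒n≤o N₁₂ N₃₄ m≥)) (ℕ.m⊔n≤o⇒n≤o N₃ N₄ (ℕ.m⊔n≤o⇒n≤o N₁₂ N₃₄ n≥)))
        (p m n (ℕ.m⊔n≤o⇒m≤o N₃ N₄ (ℕ.m⊔n≤o⇒n≤o N₁₂ N₃₄ m≥)) (ℕ.m⊔n≤o⇒m≤o N₃ N₄ (ℕ.m⊔n≤o⇒n≤o N₁₂ N₃₄ n≥)))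

    *-inv₀ : ∀ p → 0ℚ < p → p * inv₀ p ≡ 1ℚ
    *-inv₀ p 0<p with p ≟ 0ℚ
    ... | yes p≡0 = contradiction (sym p≡0) (<⇒≢ 0<p)
    ... | no  p≢0 = *-inverseʳ p {{≢-nonZero p≢0}}

    inv-cauchy : ∀ x → IsCauchy x → Eventually>0 x → IsCauchy (λ n → inv₀ (x n))
    inv-cauchy x cx (δ , 0<δ , N , δ≤) = c
      where
      open +-*-Solver
      open ≤-Reasoning
      instance
        δ+ : Positive δ
        δ+ = positive 0<δ
        δδ+ : Positive (δ * δ)
        δδ+ = pos*pos⇒pos δ δ
      c : IsCauchy (λ n → inv₀ (x n))
      c ε 0<ε with cx (ε * (δ * δ)) (positive⁻¹ _ {{pos*pos⇒pos ε {{positive 0<ε}} (δ * δ)}})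
      ... | M , h = N ℕ.⊔ M , λ m n m≥ n≥ →
        let p  = x m
            q  = x n
            δ≤p = δ≤ m (ℕ.m⊔n≤o⇒m≤o N M m≥)
            δ≤q = δ≤ n (ℕ.m⊔n≤o⇒m≤o N M n≥)
            0<p = <-≤-trans 0<δ δ≤p
            0<q = <-≤-trans 0<δ δ≤q
            D  = inv₀ p - inv₀ q
            instance _ : Positive p
                     _ = positive 0<p
        in *-cancelʳ-<-nonNeg (δ * δ) {{pos⇒nonNeg (δ * δ)}} (begin-strict
          ∣ D ∣ * (δ * δ)
            ≤⟨ *-monoˡ-≤-nonNeg ∣ D ∣ {{∣-∣-nonNeg D}} (≤-trans (*-monoʳ-≤-nonNeg δ {{pos⇒nonNeg δ}} δ≤p) (*-monoˡ-≤-nonNeg p {{pos⇒nonNeg p}} δ≤q)) ⟩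
          ∣ D ∣ * (p * q)
            ≡⟨ cong (∣ D ∣ *_) (sym (0≤p⇒∣p∣≡p (<⇒≤ (positive⁻¹ (p * q) {{pos*pos⇒pos p q {{positive 0<q}}}})))) ⟩
          ∣ D ∣ * ∣ p * q ∣ ≡⟨ sym (∣p*q∣≡∣p∣*∣q∣ D (p * q)) ⟩
          ∣ D * (p * q) ∣
            ≡⟨ cong ∣_∣ (trans (solve 4 (λ i j p q → (i :- j) :* (p :* q) := q :* (p :* i) :- p :* (q :* j)) refl (inv₀ p) (inv₀ q) p q)
                               (cong₂ (λ a b → q * a - p * b) (*-inv₀ p 0<p) (*-inv₀ q 0<q))) ⟩
          ∣ q * 1ℚ - p * 1ℚ ∣ ≡⟨ cong₂ (λ a b → ∣ a - b ∣) (*-identityʳ q) (*-identityʳ p) ⟩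
          ∣ q - p ∣ <⟨ h n m (ℕ.m⊔n≤o⇒n≤o N M n≥) (ℕ.m⊔n≤o⇒n≤o N M m≥) ⟩
          ε * (δ * δ) ∎)

    isqrt-lower : ∀ n → isqrt n ℕ.* isqrt n ℕ.≤ n
    isqrt-lower zero    = ℕ.z≤n
    isqrt-lower (suc n) with suc (isqrt n) ℕ.* suc (isqrt n) ℕ.≤? suc n
    ... | yes p = p
    ... | no  _ = ℕ.m≤n⇒m≤1+n (isqrt-lower n)

    isqrt-upper : ∀ n → n ℕ.< suc (isqrt n) ℕ.* suc (isqrt n)
    isqrt-upper zero    = ℕ.s≤s ℕ.z≤n
    isqrt-upper (suc n) with suc (isqrt n) ℕ.* suc (isqrt n) ℕ.≤? suc n
    ... | no  p = ℕ.≰⇒> p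
    ... | yes _ = ℕ.≤-<-trans (isqrt-upper n) (ℕ.*-mono-< (ℕ.n<1+n (suc (isqrt n))) (ℕ.n<1+n (suc (isqrt n))))

    sq-cancel-< : ∀ a b → a ℕ.* a ℕ.< b ℕ.* b → a ℕ.< b
    sq-cancel-< a b h = ℕ.≰⇒> λ b≤a → ℕ.<⇒≱ h (ℕ.*-mono-≤ b≤a b≤a)

    toℚᵘ-/ : ∀ i k → toℚᵘ (i / suc k) ℚᵘ.≃ ℚᵘ.mkℚᵘ i k
    toℚᵘ-/ i k = toℚᵘ-fromℚᵘ (ℚᵘ.mkℚᵘ i k)

    /-mono-< : ∀ a j b k → a ℕ.* suc k ℕ.< b ℕ.* suc j → + a / suc j < + b / suc k
    /-mono-< a j b k h = toℚᵘ-cancel-<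
      (ℚᵘ.<-respˡ-≃ (ℚᵘ.≃-sym (toℚᵘ-/ (+ a) j)) (ℚᵘ.<-respʳ-≃ (ℚᵘ.≃-sym (toℚᵘ-/ (+ b) k))
        (ℚᵘ.*<* (subst₂ ℤ._<_ (ℤ.pos-* a (suc k)) (ℤ.pos-* b (suc j)) (ℤ.+<+ h)))))

    /-mono-≤ : ∀ a j b k → a ℕ.* suc k ℕ.≤ b ℕ.* suc j → + a / suc j ≤ + b / suc k
    /-mono-≤ a j b k h = toℚᵘ-cancel-≤
      (ℚᵘ.≤-respˡ-≃ (ℚᵘ.≃-sym (toℚᵘ-/ (+ a) j)) (ℚᵘ.≤-respʳ-≃ (ℚᵘ.≃-sym (toℚᵘ-/ (+ b) k))
        (ℚᵘ.*≤* (subst₂ ℤ._≤_ (ℤ.pos-* a (suc k)) (ℤ.pos-* b (suc j)) (ℤ.+≤+ h)))))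

    suc/ : ∀ b k → + suc b / suc k ≡ + b / suc k + + 1 / suc k
    suc/ b k = toℚᵘ-injective (ℚᵘ.≃-trans (toℚᵘ-/ (+ suc b) k) (ℚᵘ.≃-trans e
      (ℚᵘ.≃-sym (ℚᵘ.≃-trans (toℚᵘ-homo-+ (+ b / suc k) (+ 1 / suc k))
                             (ℚᵘ.+-cong (toℚᵘ-/ (+ b) k) (toℚᵘ-/ (+ 1) k))))))
      where
      e : ℚᵘ.mkℚᵘ (+ suc b) k ℚᵘ.≃ ℚᵘ.mkℚᵘ (+ b) k ℚᵘ.+ ℚᵘ.mkℚᵘ (+ 1) k
      e = ℚᵘ.*≡* (trans (cong (ℤ._* (+ suc k ℤ.* + suc k)) (cong +_ (ℕ.+-comm 1 b)))
            (solve 2 (λ x K → (x :+ con (+ 1)) :* (K :* K) := (x :* K :+ con (+ 1) :* K) :* K) refl (+ b) (+ suc k)))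
        where open ℤ-Solver.+-*-Solver

    archimedean : ∀ ε → 0ℚ < ε → ∃ λ N → ∀ n → N ℕ.≤ n → + 1 / suc n ≤ ε
    archimedean ε@(mkℚ (+ zero) _ _) 0<ε = contradiction (positive 0<ε) λ ()
    archimedean (mkℚ -[1+ _ ] _ _) 0<ε = contradiction (positive 0<ε) λ ()
    archimedean ε@(mkℚ (+ suc p) q _) 0<ε = q , λ n q≤n →
      subst (+ 1 / suc n ≤_) (↥p/↧p≡p ε) (/-mono-≤ 1 n (suc p) q (h n q≤n))
      where
      h : ∀ n → q ℕ.≤ n → 1 ℕ.* suc q ℕ.≤ suc p ℕ.* suc n
      h n q≤n = ℕ.*-mono-≤ (ℕ.s≤s (ℕ.z≤n {p})) (ℕ.s≤s q≤n)

    √-close : ∀ m j k → √-seq m j < √-seq m k + + 1 / suc k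
    √-close m j k = subst (√-seq m j <_) (suc/ b k)
      (/-mono-< a j (suc b) k (sq-cancel-< (a ℕ.* K) (suc b ℕ.* J) (begin-strict
        (a ℕ.* K) ℕ.* (a ℕ.* K)     ≡⟨ ℕ.[m*n]*[o*p]≡[m*o]*[n*p] a K a K ⟩
        (a ℕ.* a) ℕ.* (K ℕ.* K)     ≤⟨ ℕ.*-monoˡ-≤ (K ℕ.* K) (isqrt-lower (m ℕ.* (J ℕ.* J))) ⟩
        (m ℕ.* (J ℕ.* J)) ℕ.* (K ℕ.* K)
          ≡⟨ trans (ℕ.*-assoc m (J ℕ.* J) _) (trans (cong (m ℕ.*_) (ℕ.*-comm (J ℕ.* J) _)) (sym (ℕ.*-assoc m (K ℕ.* K) _))) ⟩
        (m ℕ.* (K ℕ.* K)) ℕ.* (J ℕ.* J)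
          <⟨ ℕ.*-monoˡ-< (J ℕ.* J) (isqrt-upper (m ℕ.* (K ℕ.* K))) ⟩
        (suc b ℕ.* suc b) ℕ.* (J ℕ.* J) ≡⟨ ℕ.[m*n]*[o*p]≡[m*o]*[n*p] (suc b) (suc b) J J ⟩
        (suc b ℕ.* J) ℕ.* (suc b ℕ.* J) ∎)))
      where
      open ℕ.≤-Reasoning
      J = suc j
      K = suc k
      a = isqrt (m ℕ.* (J ℕ.* J))
      b = isqrt (m ℕ.* (K ℕ.* K))

    √-cauchy : ∀ m → IsCauchy (√-seq m)
    √-cauchy m ε 0<ε = let N , h = archimedean ε 0<ε in N , λ j k j≥ k≥ → ∣-∣<
      (<-≤-trans (p<q+r⇒p-q<r (√-close m j k)) (h k k≥))
      (subst (_< ε) (solve 2 (λ p q → q :- p := :- (p :- q)) refl (√-seq m j) (√-seq m k))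
        (<-≤-trans (p<q+r⇒p-q<r (√-close m k j)) (h j j≥)))
      where open +-*-Solver

  fromℚ : ℚ → ℝ
  fromℚ p = mkℝ (λ _ → p) (const-cauchy p)

  0ℝ : ℝ
  0ℝ = fromℚ 0ℚ

  infixl 6 _⊕_
  _⊕_ : ℝ → ℝ → ℝ
  x ⊕ y = mkℝ (λ n → seq x n + seq y n) (+-cauchy (seq x) (seq y) (cauchy x) (cauchy y))

  infixl 7 _⊗_
  _⊗_ : ℝ → ℝ → ℝ
  x ⊗ y = mkℝ (λ n → seq x n * seq y n) (*-cauchy (seq x) (seq y) (cauchy x) (cauchy y))

  infix 8 _⁻¹[_]
  _⁻¹[_] : (x : ℝ) → 0< x → ℝ
  x ⁻¹[ 0<x ] = mkℝ (λ n → inv₀ (seq x n)) (inv-cauchy (seq x) (cauchy x) 0<x)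

  -- The n-th approximation of √ m is ⌊ √ (m (n+1)²) ⌋ / (n+1).
  √_ : ℕ → ℝ
  √ m = mkℝ (√-seq m) (√-cauchy m)

  √-pos : ∀ m → 0 ℕ.< m → 0< (√ m)
  √-pos m 0<m = 1ℚ , positive⁻¹ 1ℚ , 0 , λ k _ →
    subst (_≤ √-seq m k) refl (/-mono-≤ 1 0 (isqrt (m ℕ.* (suc k ℕ.* suc k))) k (h k))
    where
    h : ∀ k → 1 ℕ.* suc k ℕ.≤ isqrt (m ℕ.* (suc k ℕ.* suc k)) ℕ.* 1
    h k = subst₂ ℕ._≤_ (sym (ℕ.*-identityˡ (suc k))) (sym (ℕ.*-identityʳ _))
      (ℕ.≤-pred (sq-cancel-< (suc k) (suc b) (ℕ.≤-<-trans
        (subst (ℕ._≤ m ℕ.* K²) (ℕ.*-identityˡ K²) (ℕ.*-monoˡ-≤ K² 0<m)) (isqrt-upper (m ℕ.* K²)))))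
      where K² = suc k ℕ.* suc k
            b = isqrt (m ℕ.* K²)

open Real using (ℝ; 0ℝ; _⊕_; _⊗_; _⁻¹[_]; √_; √-pos; _≃_; fromℚ) public

-- ω = (1 + √d)/2 if d ≡ 1 (mod 4), and ω = √d otherwise; in either case
-- ω² = τ ω + κ.  In the first case κ = (d - 1)/4, the floor of d/4.

τ κ : ℤ → ℤ
τ d with d ℤ.%ℕ 4
... | 1 = 1ℤ
... | _ = 0ℤ
κ d with d ℤ.%ℕ 4
... | 1 = d ℤ./ℕ 4
... | _ = d

-- ⟨ a , b ⟩ stands for a + b ω.

record 𝒪 (d : ℤ) : Set where
  no-eta-equality; pattern
  constructor ⟨_,_⟩
  field
    rat  : ℤ
    coef : ℤ
open 𝒪 public

module _ {d : ℤ} where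

  infixl 6 _+_
  infixl 7 _*_
  infix  8 -_

  _+_ _*_ : 𝒪 d → 𝒪 d → 𝒪 d
  ⟨ a , b ⟩ + ⟨ c , e ⟩ = ⟨ a ℤ.+ c , b ℤ.+ e ⟩
  ⟨ a , b ⟩ * ⟨ c , e ⟩ =
    ⟨ a ℤ.* c ℤ.+ κ d ℤ.* (b ℤ.* e) , a ℤ.* e ℤ.+ b ℤ.* c ℤ.+ τ d ℤ.* (b ℤ.* e) ⟩

  -_ : 𝒪 d → 𝒪 d
  - ⟨ a , b ⟩ = ⟨ ℤ.- a , ℤ.- b ⟩

  0# 1# : 𝒪 d
  0# = ⟨ 0ℤ , 0ℤ ⟩
  1# = ⟨ 1ℤ , 0ℤ ⟩

  -- ω̄ = τ - ω
  conj : 𝒪 d → 𝒪 d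
  conj ⟨ a , b ⟩ = ⟨ a ℤ.+ τ d ℤ.* b , ℤ.- b ⟩

  -- For d < 0 this is z z̄ itself: see *-conj.
  norm : 𝒪 d → ℕ
  norm z = ℤ.∣ rat (z * conj z) ∣

  modulus : 𝒪 d → ℝ
  modulus z = √ norm z

  _≟_ : DecidableEquality (𝒪 d)
  ⟨ a , b ⟩ ≟ ⟨ c , e ⟩ =
    map′ (λ { (refl , refl) → refl }) (λ { refl → refl , refl }) ((a ℤ.≟ c) ×-dec (b ℤ.≟ e))

  private
    open ℤ-Solver.+-*-Solver

    *-assoc : ∀ x y z → (x * y) * z ≡ x * (y * z)
    *-assoc ⟨ a , b ⟩ ⟨ c , e ⟩ ⟨ f , g ⟩ = cong₂ ⟨_,_⟩
      (solve 8 (λ a b c e f g t k →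
        (a :* c :+ k :* (b :* e)) :* f :+ k :* ((a :* e :+ b :* c :+ t :* (b :* e)) :* g)
        := a :* (c :* f :+ k :* (e :* g)) :+ k :* (b :* (c :* g :+ e :* f :+ t :* (e :* g))))
        refl a b c e f g (τ d) (κ d))
      (solve 8 (λ a b c e f g t k →
        (a :* c :+ k :* (b :* e)) :* g :+ (a :* e :+ b :* c :+ t :* (b :* e)) :* f
          :+ t :* ((a :* e :+ b :* c :+ t :* (b :* e)) :* g)
        := a :* (c :* g :+ e :* f :+ t :* (e :* g)) :+ b :* (c :* f :+ k :* (e :* g))
          :+ t :* (b :* (c :* g :+ e :* f :+ t :* (e :* g))))
        refl a b c e f g (τ d) (κ d))

    *-comm : ∀ x y → x * y ≡ y * x
    *-comm ⟨ a , b ⟩ ⟨ c , e ⟩ = cong₂ ⟨_,_⟩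
      (solve 5 (λ a b c e k → a :* c :+ k :* (b :* e) := c :* a :+ k :* (e :* b)) refl a b c e (κ d))
      (solve 5 (λ a b c e t → a :* e :+ b :* c :+ t :* (b :* e) := c :* b :+ e :* a :+ t :* (e :* b))
        refl a b c e (τ d))

    *-identityˡ : ∀ x → 1# * x ≡ x
    *-identityˡ ⟨ a , b ⟩ = cong₂ ⟨_,_⟩
      (solve 3 (λ a b k → con 1ℤ :* a :+ k :* (con 0ℤ :* b) := a) refl a b (κ d))
      (solve 3 (λ a b t → con 1ℤ :* b :+ con 0ℤ :* a :+ t :* (con 0ℤ :* b) := b) refl a b (τ d))

    *-distribˡ-+ : ∀ x y z → x * (y + z) ≡ x * y + x * z
    *-distribˡ-+ ⟨ a , b ⟩ ⟨ c , e ⟩ ⟨ f , g ⟩ = cong₂ ⟨_,_⟩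
      (solve 7 (λ a b c e f g k → a :* (c :+ f) :+ k :* (b :* (e :+ g))
        := (a :* c :+ k :* (b :* e)) :+ (a :* f :+ k :* (b :* g))) refl a b c e f g (κ d))
      (solve 7 (λ a b c e f g t → a :* (e :+ g) :+ b :* (c :+ f) :+ t :* (b :* (e :+ g))
        := (a :* e :+ b :* c :+ t :* (b :* e)) :+ (a :* g :+ b :* f :+ t :* (b :* g))) refl a b c e f g (τ d))

  isCommutativeRing : IsCommutativeRing _≡_ _+_ _*_ -_ 0# 1#
  isCommutativeRing = record
    { isRing = record
      { +-isAbelianGroup = record
        { isGroup = record
          { isMonoid = record
            { isSemigroup = record
              { isMagma = record { isEquivalence = isEquivalence ; ∙-cong = cong₂ _+_ }
              ; assoc = λ { ⟨ a , b ⟩ ⟨ c , e ⟩ ⟨ f , g ⟩ → cong₂ ⟨_,_⟩ (ℤ.+-assoc a c f) (ℤ.+-assoc b e g) }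
              }
            ; identity = (λ { ⟨ a , b ⟩ → cong₂ ⟨_,_⟩ (ℤ.+-identityˡ a) (ℤ.+-identityˡ b) })
                       , (λ { ⟨ a , b ⟩ → cong₂ ⟨_,_⟩ (ℤ.+-identityʳ a) (ℤ.+-identityʳ b) })
            }
          ; inverse = (λ { ⟨ a , b ⟩ → cong₂ ⟨_,_⟩ (ℤ.+-inverseˡ a) (ℤ.+-inverseˡ b) })
                    , (λ { ⟨ a , b ⟩ → cong₂ ⟨_,_⟩ (ℤ.+-inverseʳ a) (ℤ.+-inverseʳ b) })
          ; ⁻¹-cong = cong -_
          }
        ; comm = λ { ⟨ a , b ⟩ ⟨ c , e ⟩ → cong₂ ⟨_,_⟩ (ℤ.+-comm a c) (ℤ.+-comm b e) }
        }
      ; *-cong = cong₂ _*_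
      ; *-assoc = *-assoc
      ; *-identity = *-identityˡ , (λ x → trans (*-comm x 1#) (*-identityˡ x))
      ; distrib = *-distribˡ-+ , (λ x y z → trans (*-comm (y + z) x)
          (trans (*-distribˡ-+ x y z) (cong₂ _+_ (*-comm x y) (*-comm x z))))
      }
    ; *-comm = *-comm
    }

𝒪-commutativeRing : ℤ → CommutativeRing _ _
𝒪-commutativeRing d = record { isCommutativeRing = isCommutativeRing {d} }

𝒪-rawSemiring : ℤ → RawSemiring _ _
𝒪-rawSemiring d = record { Carrier = 𝒪 d ; _≈_ = _≡_ ; _+_ = _+_ ; _*_ = _*_ ; 0# = 0# ; 1# = 1# }

-- Coprime x y says that every common divisor of x and y divides 1#.

module _ {d : ℤ} where
  open RawSemiringDefinitions (𝒪-rawSemiring d) public using (_∣_; Coprime)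
  open RawMagmaDefinitions (RawSemiring.*-rawMagma (𝒪-rawSemiring d)) public using () renaming (_,_ to divides)

-- 2 z = re₂ z + im₂ z √d, so for d < 0 these have the signs of the real
-- and the imaginary part, and tan (arg z) = √-d (im₂ z) / (re₂ z).

module _ {d : ℤ} where
  re₂ im₂ : 𝒪 d → ℤ
  re₂ z = + 2 ℤ.* rat z ℤ.+ τ d ℤ.* coef z
  im₂ z = (+ 2 ℤ.- τ d) ℤ.* coef z

-- For z ≠ 0 and d < 0, the three clauses say 0 ≤ arg z < θ with θ = π/2 for
-- d = -1, θ = π/3 for d = -3 (where tan θ = √3) and θ = π for the other d.

InSector : (d : ℤ) → 𝒪 d → Set
InSector -[1+ 0 ] z = 0ℤ ℤ.< re₂ z × 0ℤ ℤ.≤ im₂ z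
InSector -[1+ 2 ] z = 0ℤ ℤ.≤ im₂ z × im₂ z ℤ.< re₂ z
InSector _        z = 0ℤ ℤ.< im₂ z ⊎ (im₂ z ≡ 0ℤ × 0ℤ ℤ.< re₂ z)

inSector? : ∀ d (z : 𝒪 d) → Dec (InSector d z)
inSector? -[1+ 0 ] z = (0ℤ ℤ.<? re₂ z) ×-dec (0ℤ ℤ.≤? im₂ z)
inSector? -[1+ 2 ] z = (0ℤ ℤ.≤? im₂ z) ×-dec (im₂ z ℤ.<? re₂ z)
inSector? -[1+ 1 ] z = (0ℤ ℤ.<? im₂ z) ⊎-dec ((im₂ z ℤ.≟ 0ℤ) ×-dec (0ℤ ℤ.<? re₂ z))
inSector? -[1+ suc (suc (suc n)) ] z = (0ℤ ℤ.<? im₂ z) ⊎-dec ((im₂ z ℤ.≟ 0ℤ) ×-dec (0ℤ ℤ.<? re₂ z))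
inSector? (+ n) z = (0ℤ ℤ.<? im₂ z) ⊎-dec ((im₂ z ℤ.≟ 0ℤ) ×-dec (0ℤ ℤ.<? re₂ z))

A : (d : ℤ) → 𝒪 d → Set
A d z = z ≢ 0# × InSector d z

-- y below is z / x.

infix 4 _◇_
_◇_ : ∀ {d} → 𝒪 d → 𝒪 d → Set
_◇_ {d} x z = A d x × ∃ λ y → y * x ≡ z × Coprime x y

module _ {d : ℤ} where

  private
    open ℤ-Solver.+-*-Solver

    pos*pos : ∀ b → b ℤ.* b ≡ + (ℤ.∣ b ∣ ℕ.* ℤ.∣ b ∣)
    pos*pos (+ n)    = sym (ℤ.pos-* n n)
    pos*pos -[1+ n ] = refl

    disc : ℤ
    disc = τ d ℤ.* τ d ℤ.+ + 4 ℤ.* κ d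

    4d<0 : d ℤ.< 0ℤ → 0ℤ ℤ.* 0ℤ ℤ.+ + 4 ℤ.* d ℤ.< 0ℤ
    4d<0 d<0 = subst (ℤ._< 0ℤ) (sym (ℤ.+-identityˡ (+ 4 ℤ.* d))) (ℤ.*-monoˡ-<-pos (+ 4) d<0)

    disc<0 : d ℤ.< 0ℤ → disc ℤ.< 0ℤ
    disc<0 d<0 with d ℤ.%ℕ 4 in e
    ... | 0           = 4d<0 d<0
    ... | suc (suc _) = 4d<0 d<0
    ... | 1 = subst (ℤ._< 0ℤ) (trans (ℤ.a≡a%ℕn+[a/ℕn]*n d 4)
        (trans (cong (λ r → + r ℤ.+ (d ℤ./ℕ 4) ℤ.* + 4) e)
               (solve 1 (λ q → con 1ℤ :+ q :* con (+ 4) := con 1ℤ :* con 1ℤ :+ con (+ 4) :* q) refl (d ℤ./ℕ 4)))) d<0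

    τ≤1 : ℤ.∣ τ d ∣ ℕ.≤ 1
    τ≤1 with d ℤ.%ℕ 4
    ... | 0           = ℕ.z≤n
    ... | 1           = ℕ.s≤s ℕ.z≤n
    ... | suc (suc _) = ℕ.z≤n

    complete-square : ∀ (z : 𝒪 d) → + 4 ℤ.* rat (z * conj z) ≡ re₂ z ℤ.* re₂ z ℤ.+ (ℤ.- disc) ℤ.* (coef z ℤ.* coef z)
    complete-square ⟨ a , b ⟩ = solve 4 (λ a b t k →
      con (+ 4) :* (a :* (a :+ t :* b) :+ k :* (b :* (:- b)))
      := (con (+ 2) :* a :+ t :* b) :* (con (+ 2) :* a :+ t :* b) :+ (:- (t :* t :+ con (+ 4) :* k)) :* (b :* b))
      refl a b (τ d) (κ d)

    norm-lemma : d ℤ.< 0ℤ → (z : 𝒪 d) →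
      rat (z * conj z) ≡ + norm z ×
      ℤ.∣ re₂ z ∣ ℕ.* ℤ.∣ re₂ z ∣ ℕ.≤ 4 ℕ.* norm z ×
      ℤ.∣ coef z ∣ ℕ.* ℤ.∣ coef z ∣ ℕ.≤ 4 ℕ.* norm z
    norm-lemma d<0 z = go (rat (z * conj z)) (ℤ.- disc) (ℤ.neg-mono-< (disc<0 d<0)) (complete-square z)
      where
      X² = ℤ.∣ re₂ z ∣ ℕ.* ℤ.∣ re₂ z ∣
      b² = ℤ.∣ coef z ∣ ℕ.* ℤ.∣ coef z ∣
      go : ∀ n D → 0ℤ ℤ.< D → + 4 ℤ.* n ≡ re₂ z ℤ.* re₂ z ℤ.+ D ℤ.* (coef z ℤ.* coef z) →
           n ≡ + ℤ.∣ n ∣ × X² ℕ.≤ 4 ℕ.* ℤ.∣ n ∣ × b² ℕ.≤ 4 ℕ.* ℤ.∣ n ∣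
      go n (+ suc D) _ eq = sign n eq′ , subst (X² ℕ.≤_) (sym abs-eq) (ℕ.m≤m+n X² _) ,
        subst (b² ℕ.≤_) (sym abs-eq) (ℕ.≤-trans (ℕ.m≤m+n b² (D ℕ.* b²)) (ℕ.m≤n+m _ X²))
        where
        eq′ : + 4 ℤ.* n ≡ + (X² ℕ.+ suc D ℕ.* b²)
        eq′ = trans eq (cong₂ ℤ._+_ (pos*pos (re₂ z))
          (trans (cong (+ suc D ℤ.*_) (pos*pos (coef z))) (sym (ℤ.pos-* (suc D) b²))))
        abs-eq : 4 ℕ.* ℤ.∣ n ∣ ≡ X² ℕ.+ suc D ℕ.* b²
        abs-eq = trans (sym (ℤ.abs-* (+ 4) n)) (cong ℤ.∣_∣ eq′)
        sign : ∀ n {k} → + 4 ℤ.* n ≡ + k → n ≡ + ℤ.∣ n ∣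
        sign (+ n)    _  = refl
        sign -[1+ n ] ()
      go n (+ zero) (ℤ.+<+ ()) _

    m≤m*m : ∀ m → m ℕ.≤ m ℕ.* m
    m≤m*m zero    = ℕ.z≤n
    m≤m*m (suc m) = ℕ.m≤m*n (suc m) (suc m)

  *-conj : d ℤ.< 0ℤ → (z : 𝒪 d) → z * conj z ≡ ⟨ + norm z , 0ℤ ⟩
  *-conj d<0 z@(⟨ a , b ⟩) = cong₂ ⟨_,_⟩ (proj₁ (norm-lemma d<0 z))
    (solve 3 (λ a b t → a :* (:- b) :+ b :* (a :+ t :* b) :+ t :* (b :* (:- b)) := con 0ℤ) refl a b (τ d))

  norm-* : (x y : 𝒪 d) → norm (x * y) ≡ norm x ℕ.* norm y
  norm-* x@(⟨ a , b ⟩) y@(⟨ c , e ⟩) = trans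
    (cong ℤ.∣_∣ (solve 6 (λ a b c e t k →
      let p = a :* c :+ k :* (b :* e)
          q = a :* e :+ b :* c :+ t :* (b :* e)
      in p :* (p :+ t :* q) :+ k :* (q :* (:- q))
         := (a :* (a :+ t :* b) :+ k :* (b :* (:- b))) :* (c :* (c :+ t :* e) :+ k :* (e :* (:- e))))
      refl a b c e (τ d) (κ d)))
    (ℤ.abs-* (rat (x * conj x)) (rat (y * conj y)))

  module _ (d<0 : d ℤ.< 0ℤ) where

    coef-bound : ∀ (z : 𝒪 d) → ℤ.∣ coef z ∣ ℕ.≤ 4 ℕ.* norm z
    coef-bound z = ℕ.≤-trans (m≤m*m _) (proj₂ (proj₂ (norm-lemma d<0 z)))

    rat-bound : ∀ (z : 𝒪 d) → ℤ.∣ rat z ∣ ℕ.≤ 8 ℕ.* norm z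
    rat-bound z@(⟨ _ , _ ⟩) = begin
      ℤ.∣ a ∣                            ≤⟨ ℕ.m≤m+n ℤ.∣ a ∣ _ ⟩
      2 ℕ.* ℤ.∣ a ∣                      ≡⟨ sym (ℤ.abs-* (+ 2) a) ⟩
      ℤ.∣ + 2 ℤ.* a ∣                    ≡⟨ cong ℤ.∣_∣ (solve 3 (λ a b t → con (+ 2) :* a := (con (+ 2) :* a :+ t :* b) :- t :* b) refl a b (τ d)) ⟩
      ℤ.∣ re₂ z ℤ.- τ d ℤ.* b ∣          ≤⟨ ℤ.∣i-j∣≤∣i∣+∣j∣ (re₂ z) (τ d ℤ.* b) ⟩
      ℤ.∣ re₂ z ∣ ℕ.+ ℤ.∣ τ d ℤ.* b ∣    ≤⟨ ℕ.+-mono-≤ (ℕ.≤-trans (m≤m*m _) (proj₁ (proj₂ (norm-lemma d<0 z)))) (begin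
        ℤ.∣ τ d ℤ.* b ∣            ≡⟨ ℤ.abs-* (τ d) b ⟩
        ℤ.∣ τ d ∣ ℕ.* ℤ.∣ b ∣      ≤⟨ ℕ.*-monoˡ-≤ ℤ.∣ b ∣ τ≤1 ⟩
        1 ℕ.* ℤ.∣ b ∣              ≡⟨ ℕ.*-identityˡ ℤ.∣ b ∣ ⟩
        ℤ.∣ b ∣                    ≤⟨ coef-bound z ⟩
        4 ℕ.* norm z ∎) ⟩
      4 ℕ.* norm z ℕ.+ 4 ℕ.* norm z      ≡⟨ sym (ℕ.*-distribʳ-+ (norm z) 4 4) ⟩
      8 ℕ.* norm z ∎
      where
      open ℕ.≤-Reasoning
      a = rat z
      b = coef z

    norm≡0⇒≡0 : ∀ (z : 𝒪 d) → norm z ≡ 0 → z ≡ 0#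
    norm≡0⇒≡0 z@(⟨ _ , _ ⟩) n≡0 = cong₂ ⟨_,_⟩
      (ℤ.∣i∣≡0⇒i≡0 (ℕ.n≤0⇒n≡0 (subst (λ n → ℤ.∣ rat z ∣ ℕ.≤ 8 ℕ.* n) n≡0 (rat-bound z))))
      (ℤ.∣i∣≡0⇒i≡0 (ℕ.n≤0⇒n≡0 (subst (λ n → ℤ.∣ coef z ∣ ℕ.≤ 4 ℕ.* n) n≡0 (coef-bound z))))

    norm-pos : ∀ (z : 𝒪 d) → z ≢ 0# → 0 ℕ.< norm z
    norm-pos z z≢0 = ℕ.n≢0⇒n>0 (z≢0 ∘ norm≡0⇒≡0 z)

  integers : ℕ → List ℤ
  integers n = map +_ (upTo (suc n)) ++ map -[1+_] (upTo n)

  box : ℕ → List (𝒪 d)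
  box n = cartesianProductWith ⟨_,_⟩ (integers n) (integers n)

  private
    ∈-integers : ∀ n i → ℤ.∣ i ∣ ℕ.≤ n → i ∈ integers n
    ∈-integers n (+ i)    i≤n = ∈.∈-++⁺ˡ (∈.∈-map⁺ +_ (∈.∈-upTo⁺ (ℕ.s≤s i≤n)))
    ∈-integers n -[1+ i ] i<n = ∈.∈-++⁺ʳ (map +_ (upTo (suc n))) (∈.∈-map⁺ -[1+_] (∈.∈-upTo⁺ i<n))

    integers-unique : ∀ n → Unique (integers n)
    integers-unique n = Unique.++⁺
      (Unique.map⁺ ℤ.+-injective (Unique.upTo⁺ (suc n)))
      (Unique.map⁺ ℤ.-[1+-injective (Unique.upTo⁺ n))
      λ (p , q) → disjoint (proj₂ (proj₂ (∈.∈-map⁻ +_ p))) (proj₂ (proj₂ (∈.∈-map⁻ -[1+_] q)))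
      where
      disjoint : ∀ {i m n} → i ≡ + m → i ≢ -[1+ n ]
      disjoint refl ()

  box-unique : ∀ n → Unique (box n)
  box-unique n = Unique.cartesianProductWith⁺ ⟨_,_⟩ (λ { refl → refl , refl }) (integers-unique n) (integers-unique n)

  module _ (d<0 : d ℤ.< 0ℤ) where

    ∈-box : ∀ (z : 𝒪 d) n → norm z ℕ.≤ n → z ∈ box (8 ℕ.* n)
    ∈-box z@(⟨ _ , _ ⟩) n h = ∈.∈-cartesianProductWith⁺ ⟨_,_⟩
      (∈-integers _ (rat z) (ℕ.≤-trans (rat-bound d<0 z) (ℕ.*-monoʳ-≤ 8 h)))
      (∈-integers _ (coef z) (ℕ.≤-trans (coef-bound d<0 z) (ℕ.*-mono-≤ (ℕ.m≤m+n 4 4) h)))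

    cofactor-norm : ∀ (x y : 𝒪 d) {z} → x ≢ 0# → y * x ≡ z → norm y ℕ.≤ norm z
    cofactor-norm x y x≢0 refl = subst (norm y ℕ.≤_) (sym (norm-* y x))
      (ℕ.m≤m*n (norm y) (norm x) {{ℕ.>-nonZero (norm-pos d<0 x x≢0)}})

    divisor-norm : ∀ (x y : 𝒪 d) {z} → z ≢ 0# → y * x ≡ z → norm x ℕ.≤ norm z
    divisor-norm x y z≢0 refl = subst (norm x ℕ.≤_) (sym (norm-* y x))
      (ℕ.m≤n*m (norm x) (norm y) {{ℕ.≢-nonZero λ y≡0 →
        ℕ.<⇒≢ (norm-pos d<0 _ z≢0) (sym (trans (norm-* y x) (cong (ℕ._* norm x) y≡0)))}})

    _∣?_ : Decidable (_∣_ {d})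
    x ∣? z with x ≟ 0#
    ... | no x≢0 = map′
      (λ p → let y , _ , e = find p in divides y e)
      (λ { (divides y e) → lose (∈-box y (norm z) (cofactor-norm x y x≢0 e)) e })
      (any? (λ y → (y * x) ≟ z) (box (8 ℕ.* norm z)))
    ... | yes refl = map′
      (λ { refl → divides 0# (CommutativeRing.zeroˡ (𝒪-commutativeRing d) 0#) })
      (λ { (divides y e) → trans (sym e) (CommutativeRing.zeroʳ (𝒪-commutativeRing d) y) })
      (z ≟ 0#)

    coprime? : ∀ x y → x ≢ 0# → Dec (Coprime x y)
    coprime? x y x≢0 = map′
      (λ h {u} → λ { u∣x@(divides v e) u∣y → decidable-stable (u ∣? 1#) λ u∤1 →
        All.lookup h (∈-box u (norm x) (divisor-norm u v x≢0 e)) (u∣x , u∣y , u∤1) })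
      (λ c → All.tabulate λ {u} _ (u∣x , u∣y , u∤1) → u∤1 (c u∣x u∣y))
      (All.all? (λ u → ¬? ((u ∣? x) ×-dec ((u ∣? y) ×-dec ¬? (u ∣? 1#)))) (box (8 ℕ.* norm x)))

    _◇?_ : Decidable (_◇_ {d})
    x ◇? z with x ≟ 0#
    ... | yes x≡0 = no λ ((x≢0 , _) , _) → x≢0 x≡0
    ... | no  x≢0 = map′ (λ (s , p) → let y , _ , q = find p in (x≢0 , s) , y , q)
      (λ ((_ , s) , y , e , c) → s , lose (∈-box y (norm z) (cofactor-norm x y x≢0 e)) (e , λ {u} → c {u}))
      (inSector? d x ×-dec any? (λ y → ((y * x) ≟ z) ×-dec coprime? x y x≢0) (box (8 ℕ.* norm z)))

    -- The search bound loses nothing when z ≠ 0: see ∈-unitaryDivisors.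
    unitaryDivisors : 𝒪 d → List (𝒪 d)
    unitaryDivisors z = filter (_◇? z) (box (8 ℕ.* norm z))

    unitaryDivisors-unique : ∀ z → Unique (unitaryDivisors z)
    unitaryDivisors-unique z = Unique.filter⁺ (_◇? z) (box-unique (8 ℕ.* norm z))

    ∈-unitaryDivisors : ∀ {x z} → z ≢ 0# → x ∈ unitaryDivisors z ⇔ x ◇ z
    ∈-unitaryDivisors {x} {z} z≢0 = mk⇔
      (λ p → proj₂ (∈.∈-filter⁻ (_◇? z) {xs = box (8 ℕ.* norm z)} p))
      (λ { p@(_ , y , e , _) → ∈.∈-filter⁺ (_◇? z) (∈-box x (norm z) (divisor-norm x y z≢0 e)) p })

    δ₁* : 𝒪 d → ℝ
    δ₁* z = foldr _⊕_ 0ℝ (map modulus (unitaryDivisors z))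

    I₁* : (z : 𝒪 d) → z ≢ 0# → ℝ
    I₁* z z≢0 = δ₁* z ⊗ modulus z ⁻¹[ √-pos (norm z) (norm-pos d<0 z z≢0) ]

    -- Two elements of a refinement type are equal as soon as their values are,
    -- so V (and likewise U below) is a subset.
    V : ℚ → Set
    V b = [ z ∈ 𝒪 d ∣ Σ (A d z) (λ (z≢0 , _) → I₁* z z≢0 ≃ fromℚ b) ]

fromℕ : ℕ → ℚ
fromℕ n = + n ℚ./ 1

-- The summands are the unitary divisors c = suc k of n.

σ* : ℕ → ℕ
σ* n = sum (map suc (filter
  (λ k → (suc k ℕ.∣? n) ×-dec (ℕ.gcd (suc k) (n ℕ./ suc k) ℕ.≟ 1)) (upTo n)))

U : ℚ → Set
U b = [ n ∈ ℕ ∣ (0 ℕ.< n × fromℕ (σ* n) ≡ b ℚ.* fromℕ n) ]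

ds : List ℤ
ds = map ℤ.-_ (map +_ (163 ∷ 67 ∷ 43 ∷ 19 ∷ 11 ∷ 7 ∷ 3 ∷ 2 ∷ 1 ∷ []))

ds<0 : ∀ {d} → d ∈ ds → d ℤ.< 0ℤ
ds<0 = All.lookup {P = ℤ._< 0ℤ} (ℤ.-<+ ∷ ℤ.-<+ ∷ ℤ.-<+ ∷ ℤ.-<+ ∷ ℤ.-<+ ∷ ℤ.-<+ ∷ ℤ.-<+ ∷ ℤ.-<+ ∷ ℤ.-<+ ∷ [])

{-# OPTIONS --safe #-}

-- The map g is n ↦ z with |z| = n, which makes it injective.  For a rational prime p let π be
-- p itself if p stays prime in 𝒪 d, and an element of norm p otherwise; let ρ p be π or π²
-- accordingly, so that |ρ p| = p.  Extend ρ multiplicatively and move the result into the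
-- sector A d by a unit.  Two coprime factors of a product of ρ's cannot share a factor ρ p, so
-- up to units the unitary divisors of g n are the g c with c a unitary divisor of n; as
-- |g c| = c, this gives δ₁* (g n) = σ* n.
--
-- An element of norm p exists as soon as p divides norm (r + ω) for some r, by the reduction
-- theory of binary quadratic forms: the principal form is the only reduced form of each of the
-- nine discriminants.  This replaces unique factorization.

module Submission where

open import Defs
open import Algebra.Bundles using (CommutativeRing)
import Algebra.Definitions.RawMagma as RawMagmaDefinitions
import Algebra.Properties.CommutativeMagma.Divisibility as MagmaDivisibility
import Algebra.Properties.CommutativeSemigroup.Divisibility as SemigroupDivisibility
import Algebra.Properties.Group as GroupProperties
import Algebra.Properties.Monoid.Divisibility as MonoidDivisibility
import Algebra.Properties.Ring as RingProperties
open import Data.Integer.Base as ℤ using (ℤ; +_; -[1+_]; 0ℤ; 1ℤ)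
import Data.Integer.DivMod as ℤ
import Data.Integer.Divisibility.Signed as Signed
import Data.Integer.Properties as ℤ
import Data.Integer.Solver as ℤ-Solver
open import Data.List.Base using (List; []; _∷_; _++_; map; foldr; filter; upTo)
open import Data.List.Membership.Propositional using (_∈_)
import Data.List.Membership.Propositional.Properties as ∈
open import Data.List.Membership.Propositional.Properties.WithK using (unique∧set⇒bag)
open import Data.List.Relation.Binary.BagAndSetEquality using (∼bag⇒↭)
open import Data.List.Relation.Binary.Permutation.Propositional using (_↭_; ↭⇒↭ₛ)
import Data.List.Relation.Binary.Permutation.Propositional.Properties as ↭
import Data.List.Relation.Binary.Permutation.Setoid.Properties as ↭ₛ
open import Data.List.Relation.Unary.All as All using (All; []; _∷_)
import Data.List.Relation.Unary.All.Properties as All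
open import Data.List.Relation.Unary.Any using (any?)
open import Data.List.Relation.Unary.Unique.Propositional using (Unique)
import Data.List.Relation.Unary.Unique.Propositional.Properties as Unique
open import Data.Nat.Base as ℕ using (ℕ; zero; suc)
import Data.Nat.Coprimality as ℕ
import Data.Nat.DivMod as ℕ
import Data.Nat.Divisibility as ℕ
open import Data.Nat.GCD as ℕ using (module Bézout)
import Data.Nat.Induction as ℕ
open import Data.Nat.ListAction using (sum; product)
open import Data.Nat.ListAction.Properties using (product-++)
open import Data.Nat.Primality as ℕ using (Prime)
open import Data.Nat.Primality.Factorisation using (PrimeFactorisation; factors; factorise; factorisationUnique)
import Data.Nat.Properties as ℕ
open import Data.Product.Base using (∃; _×_; _,_; proj₁; proj₂)
open import Data.Rational.Base as ℚ using (ℚ; 0ℚ; 1ℚ; _<_)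
import Data.Rational.Properties as ℚ
import Data.Rational.Unnormalised.Base as ℚᵘ
import Data.Rational.Unnormalised.Properties as ℚᵘ
import Data.Refinement as Refinement
open import Data.Sum.Base as ⊎ using (_⊎_; inj₁; inj₂)
open import Function.Base using (_∘_; id)
open import Function.Bundles using (mk⇔; module Equivalence)
open import Function.Definitions using (Injective)
open import Relation.Binary.Definitions using (tri<; tri≈; tri>)
open import Relation.Binary.PropositionalEquality
  using (_≡_; _≢_; refl; sym; trans; cong; cong₂; subst; subst₂; setoid; module ≡-Reasoning)
open import Relation.Nullary.Decidable using (Dec; yes; no; from-yes; _→-dec_; _×-dec_; True; toWitness)
open import Relation.Nullary.Negation using (¬_; contradiction)

open ≡-Reasoning
open PrimeFactorisation using (isFactorisation; factorsPrime)
open ℤ-Solver.+-*-Solver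

-- Divisibility, norms and conjugation in `𝒪 d`.

module _ {d : ℤ} where

  open CommutativeRing (𝒪-commutativeRing d) public
    using (*-comm; *-assoc; *-identityˡ; *-identityʳ; zeroˡ; zeroʳ; distribʳ)
  open MonoidDivisibility (CommutativeRing.*-monoid (𝒪-commutativeRing d)) public
    using (∣ʳ-refl; ∣ʳ-trans; x∣ʳyx)
  open MagmaDivisibility (CommutativeRing.*-commutativeMagma (𝒪-commutativeRing d)) public
    using (x∣xy)

  fromℤ : ℤ → 𝒪 d
  fromℤ i = ⟨ i , 0ℤ ⟩

  fromℤ-* : ∀ i (z : 𝒪 d) → fromℤ i * z ≡ ⟨ i ℤ.* rat z , i ℤ.* coef z ⟩
  fromℤ-* i ⟨ a , b ⟩ = cong₂ ⟨_,_⟩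
    (solve 4 (λ i a b k → i :* a :+ k :* (con 0ℤ :* b) := i :* a) refl i a b (κ d))
    (solve 4 (λ i a b t → i :* b :+ con 0ℤ :* a :+ t :* (con 0ℤ :* b) := i :* b) refl i a b (τ d))

  norm-fromℤ : ∀ i → norm {d} (fromℤ i) ≡ ℤ.∣ i ∣ ℕ.* ℤ.∣ i ∣
  norm-fromℤ i = trans
    (cong ℤ.∣_∣ (solve 3 (λ i t k → i :* (i :+ t :* con 0ℤ) :+ k :* (con 0ℤ :* (:- con 0ℤ)) := i :* i) refl i (τ d) (κ d)))
    (ℤ.abs-* i i)

  norm-1# : norm {d} 1# ≡ 1
  norm-1# = norm-fromℤ 1ℤ

  -conj-involutive : (z : 𝒪 d) → - conj (- conj z) ≡ z
  -conj-involutive ⟨ a , b ⟩ = cong₂ ⟨_,_⟩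
    (solve 3 (λ a b t → :- (:- (a :+ t :* b) :+ t :* (:- (:- b))) := a) refl a b (τ d))
    (solve 1 (λ b → :- (:- (:- (:- b))) := b) refl b)

  -conj-* : (x y : 𝒪 d) → - conj (x * y) ≡ (- conj x) * conj y
  -conj-* ⟨ a , b ⟩ ⟨ c , e ⟩ = cong₂ ⟨_,_⟩
    (solve 6 (λ a b c e t k → :- (a :* c :+ k :* (b :* e) :+ t :* (a :* e :+ b :* c :+ t :* (b :* e)))
      := (:- (a :+ t :* b)) :* (c :+ t :* e) :+ k :* ((:- (:- b)) :* (:- e))) refl a b c e (τ d) (κ d))
    (solve 5 (λ a b c e t → :- (:- (a :* e :+ b :* c :+ t :* (b :* e)))
      := (:- (a :+ t :* b)) :* (:- e) :+ (:- (:- b)) :* (c :+ t :* e) :+ t :* ((:- (:- b)) :* (:- e))) refl a b c e (τ d))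

  norm-conj : (z : 𝒪 d) → norm (conj z) ≡ norm z
  norm-conj ⟨ a , b ⟩ = cong ℤ.∣_∣ (solve 4 (λ a b t k →
    (a :+ t :* b) :* (a :+ t :* b :+ t :* (:- b)) :+ k :* ((:- b) :* (:- (:- b)))
    := a :* (a :+ t :* b) :+ k :* (b :* (:- b))) refl a b (τ d) (κ d))

  norm-neg : (z : 𝒪 d) → norm (- z) ≡ norm z
  norm-neg ⟨ a , b ⟩ = cong ℤ.∣_∣ (solve 4 (λ a b t k →
    (:- a) :* (:- a :+ t :* (:- b)) :+ k :* ((:- b) :* (:- (:- b)))
    := a :* (a :+ t :* b) :+ k :* (b :* (:- b))) refl a b (τ d) (κ d))

  norm-mono-∣ : {x y : 𝒪 d} → x ∣ y → norm x ℕ.∣ norm y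
  norm-mono-∣ {x} (divides q refl) = ℕ.divides (norm q) (norm-* q x)

  ∣1⇒norm≡1 : {x : 𝒪 d} → x ∣ 1# → norm x ≡ 1
  ∣1⇒norm≡1 {x} x∣1 = ℕ.∣1⇒≡1 (subst (norm x ℕ.∣_) norm-1# (norm-mono-∣ x∣1))

  ∣-+ : {x y z : 𝒪 d} → x ∣ y → x ∣ z → x ∣ y + z
  ∣-+ {x} (divides p refl) (divides q refl) = divides (p + q) (distribʳ x p q)

  -- Expanding `y + m w` times its conjugate gives the product for `y`, plus `m` times the trace of
  -- `y * conj w`, plus `m²` times the product for `w`; `q` collects the last two terms divided by
  -- `m`. Norms modulo `m` can thus be computed on residues.
  norm-+-* : ∀ m (y w : 𝒪 d) → m ℕ.∣ norm y → m ℕ.∣ norm (y + fromℤ (+ m) * w)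
  norm-+-* m y@(⟨ a , b ⟩) w@(⟨ u , v ⟩) m∣ = Signed.∣⇒∣ᵤ {+ m} {rat (z * conj z)}
    (subst (+ m Signed.∣_) eq (Signed.∣m∣n⇒∣m+n (Signed.∣ᵤ⇒∣ {+ m} {rat (y * conj y)} m∣) (Signed.divides q (ℤ.*-comm (+ m) q))))
    where
    z = y + fromℤ (+ m) * w
    q = + m ℤ.* (u ℤ.* (u ℤ.+ τ d ℤ.* v) ℤ.- κ d ℤ.* (v ℤ.* v))
      ℤ.+ (+ 2 ℤ.* (a ℤ.* u) ℤ.+ τ d ℤ.* (a ℤ.* v ℤ.+ b ℤ.* u) ℤ.- + 2 ℤ.* κ d ℤ.* (b ℤ.* v))
    eq : rat (y * conj y) ℤ.+ + m ℤ.* q ≡ rat (z * conj z)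
    eq = trans (solve 7 (λ a b u v m t k →
        a :* (a :+ t :* b) :+ k :* (b :* (:- b)) :+ m :* (m :* (u :* (u :+ t :* v) :- k :* (v :* v))
          :+ (con (+ 2) :* (a :* u) :+ t :* (a :* v :+ b :* u) :- con (+ 2) :* k :* (b :* v)))
        := (a :+ m :* u) :* (a :+ m :* u :+ t :* (b :+ m :* v)) :+ k :* ((b :+ m :* v) :* (:- (b :+ m :* v))))
        refl a b u v (+ m) (τ d) (κ d))
      (cong (λ w → rat ((y + w) * conj (y + w))) (sym (fromℤ-* (+ m) w)))

  -- This is `r + ω`. Up to sign its norm is `r² + τ r - κ`, the value at `r` of the minimal
  -- polynomial of `-ω`, so `p` divides the norm exactly when `r` is a root of that polynomial
  -- modulo `p`.
  θ : ℤ → 𝒪 d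
  θ r = ⟨ r , 1ℤ ⟩

  θ≢0 : ∀ r → θ r ≢ 0#
  θ≢0 r ()

  θ-+ : ∀ r m k → θ r + fromℤ m * fromℤ k ≡ θ (r ℤ.+ m ℤ.* k)
  θ-+ r m k = trans (cong (λ z → θ r + z) (fromℤ-* m (fromℤ k))) (cong₂ ⟨_,_⟩ refl (cong (λ i → 1ℤ ℤ.+ i) (ℤ.*-zeroʳ m)))

  -- Conjugation alone gives `ω` the coefficient -1; the extra sign leads back to some `θ`. This is
  -- the exchange step of form reduction.
  θ-conj : ∀ r → - conj (θ r) ≡ θ (ℤ.- (r ℤ.+ τ d))
  θ-conj r = cong₂ ⟨_,_⟩ (cong (λ t → ℤ.- (r ℤ.+ t)) (ℤ.*-identityʳ (τ d))) refl

  norm-θ-conj : ∀ r → norm (θ (ℤ.- (r ℤ.+ τ d))) ≡ norm (θ r)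
  norm-θ-conj r = trans (cong norm (sym (θ-conj r))) (trans (norm-neg (conj (θ r))) (norm-conj (θ r)))

  module _ (d<0 : d ℤ.< 0ℤ) where

    ∣-norm : (z : 𝒪 d) → z ∣ fromℤ (+ norm z)
    ∣-norm z = divides (conj z) (trans (*-comm (conj z) z) (*-conj d<0 z))

    norm≡1⇒∣1 : {z : 𝒪 d} → norm z ≡ 1 → z ∣ 1#
    norm≡1⇒∣1 {z} eq = subst (λ n → z ∣ fromℤ (+ n)) eq (∣-norm z)

    *-≢0 : {x y : 𝒪 d} → x ≢ 0# → y ≢ 0# → x * y ≢ 0#
    *-≢0 {x} {y} x≢0 y≢0 xy≡0 with ℕ.m*n≡0⇒m≡0∨n≡0 (norm x) (trans (sym (norm-* x y)) (trans (cong norm xy≡0) (norm-fromℤ 0ℤ)))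
    ... | inj₁ e = x≢0 (norm≡0⇒≡0 d<0 x e)
    ... | inj₂ e = y≢0 (norm≡0⇒≡0 d<0 y e)

    *-cancelʳ : (x y z : 𝒪 d) → z ≢ 0# → x * z ≡ y * z → x ≡ y
    *-cancelʳ x y z z≢0 eq with (x + - y) ≟ 0#
    ... | no  p = contradiction (trans (distribʳ z x (- y)) (trans (cong₂ _+_ eq (sym (-‿distribˡ-* y z))) (-‿inverseʳ (y * z)))) (*-≢0 p z≢0)
      where
      open CommutativeRing (𝒪-commutativeRing d) using (ring; -‿inverseʳ)
      open RingProperties ring using (-‿distribˡ-*)
    ... | yes p = x∙y⁻¹≈ε⇒x≈y x y p
      where
      open GroupProperties (CommutativeRing.+-group (𝒪-commutativeRing d)) using (x∙y⁻¹≈ε⇒x≈y)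

-- Binary quadratic forms

∣i∣*∣i∣≡i*i : ∀ i → + (ℤ.∣ i ∣ ℕ.* ℤ.∣ i ∣) ≡ i ℤ.* i
∣i∣*∣i∣≡i*i (+ n)    = ℤ.pos-* n n
∣i∣*∣i∣≡i*i -[1+ n ] = refl

∣m⊖n∣≤n : ∀ m n → m ℕ.≤ n ℕ.+ n → ℤ.∣ m ℤ.⊖ n ∣ ℕ.≤ n
∣m⊖n∣≤n m n m≤ with ℕ.≤-total m n
... | inj₁ m≤n = subst (ℕ._≤ n) (sym (ℤ.∣⊖∣-≤ m≤n)) (ℕ.m∸n≤m n m)
... | inj₂ n≤m = subst (ℕ._≤ n) (sym (cong ℤ.∣_∣ (ℤ.⊖-≥ n≤m))) (ℕ.m≤n+o⇒m∸n≤o m n m≤)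

-- The reduced forms (a, s, c) of discriminant s² - 4ac = -Δ have a, s < 8 when Δ ≤ 163.
OnlyPrincipalReduced : ℕ → Set
OnlyPrincipalReduced Δ = ∀ {a} → a ℕ.< 8 → ∀ {s} → s ℕ.< 8 → s ℕ.≤ a → 4 ℕ.* (a ℕ.* a) ℕ.≤ s ℕ.* s ℕ.+ Δ →
  4 ℕ.* a ℕ.∣ s ℕ.* s ℕ.+ Δ → a ℕ.≤ 1

record ClassNumberOne (d : ℤ) : Set where
  field
    Δ       : ℕ
    disc≡-Δ : τ d ℤ.* τ d ℤ.+ + 4 ℤ.* κ d ≡ ℤ.- + Δ
    Δ≤163   : Δ ℕ.≤ 163
    reduced : OnlyPrincipalReduced Δ

reduced? : ∀ Δ → Dec (OnlyPrincipalReduced Δ)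
reduced? Δ = ℕ.allUpTo? (λ a → ℕ.allUpTo? (λ s → (s ℕ.≤? a) →-dec (4 ℕ.* (a ℕ.* a) ℕ.≤? s ℕ.* s ℕ.+ Δ) →-dec
  (4 ℕ.* a ℕ.∣? s ℕ.* s ℕ.+ Δ) →-dec (a ℕ.≤? 1)) 8) 8

classNumberOne : ∀ {d} → d ∈ ds → ClassNumberOne d
classNumberOne = All.lookup {P = ClassNumberOne} (
  -- In the order of `ds`: `Δ` is `|d|` if `d` is 1 modulo 4 and `4 |d|` otherwise, hence 8 and 4
  -- for -2 and -1.
  withΔ 163 refl ∷ withΔ 67 refl ∷ withΔ 43 refl ∷ withΔ 19 refl ∷ withΔ 11 refl ∷
  withΔ 7 refl ∷ withΔ 3 refl ∷ withΔ 8 refl ∷ withΔ 4 refl ∷ [])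
  where
  withΔ : ∀ {d} Δ → τ d ℤ.* τ d ℤ.+ + 4 ℤ.* κ d ≡ ℤ.- + Δ →
        {True (Δ ℕ.≤? 163)} → {True (reduced? Δ)} → ClassNumberOne d
  withΔ Δ eq {p} {q} = record { Δ = Δ ; disc≡-Δ = eq ; Δ≤163 = toWitness p ; reduced = toWitness q }

module _ {d : ℤ} (d<0 : d ℤ.< 0ℤ) (h : ClassNumberOne d) where
  open ClassNumberOne h

  -- Completing the square. For `z = θ r` with `norm z = c a` this is the discriminant equation
  -- `4 c a = s² + Δ`, where `s = |2r + τ|`.
  4*norm : (z : 𝒪 d) → 4 ℕ.* norm z ≡ ℤ.∣ re₂ z ∣ ℕ.* ℤ.∣ re₂ z ∣ ℕ.+ Δ ℕ.* (ℤ.∣ coef z ∣ ℕ.* ℤ.∣ coef z ∣)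
  4*norm z@(⟨ a , b ⟩) = ℤ.+-injective (begin
    + (4 ℕ.* norm z)                                      ≡⟨ ℤ.pos-* 4 (norm z) ⟩
    + 4 ℤ.* + norm z                                      ≡⟨ cong (λ y → + 4 ℤ.* rat y) (*-conj d<0 z) ⟨
    + 4 ℤ.* rat (z * conj z)
      ≡⟨ solve 4 (λ a b t k →
           con (+ 4) :* (a :* (a :+ t :* b) :+ k :* (b :* (:- b)))
           := (con (+ 2) :* a :+ t :* b) :* (con (+ 2) :* a :+ t :* b) :+ (:- (t :* t :+ con (+ 4) :* k)) :* (b :* b))
           refl a b (τ d) (κ d) ⟩
    re₂ z ℤ.* re₂ z ℤ.+ (ℤ.- (τ d ℤ.* τ d ℤ.+ + 4 ℤ.* κ d)) ℤ.* (b ℤ.* b)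
      ≡⟨ cong₂ (λ x y → x ℤ.+ y ℤ.* (b ℤ.* b)) (sym (∣i∣*∣i∣≡i*i (re₂ z)))
           (trans (cong ℤ.-_ disc≡-Δ) (ℤ.neg-involutive (+ Δ))) ⟩
    + x² ℤ.+ + Δ ℤ.* (b ℤ.* b)                             ≡⟨ cong (λ y → + x² ℤ.+ + Δ ℤ.* y) (∣i∣*∣i∣≡i*i b) ⟨
    + x² ℤ.+ + Δ ℤ.* + b²                                  ≡⟨ cong (λ y → + x² ℤ.+ y) (ℤ.pos-* Δ b²) ⟨
    + (x² ℕ.+ Δ ℕ.* b²)                                   ∎)
    where
    x² = ℤ.∣ re₂ z ∣ ℕ.* ℤ.∣ re₂ z ∣
    b² = ℤ.∣ b ∣ ℕ.* ℤ.∣ b ∣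

  -- From `s ≤ a ≤ c` follows `4a² ≤ 4ca = s² + Δ ≤ a² + Δ`, so `3a² ≤ 163 < 192 = 3 · 8²` and
  -- `a < 8`. The finite table `reduced` settles the rest.
  reduced⇒≡1 : ∀ {a c s} → 0 ℕ.< a → s ℕ.≤ a → a ℕ.≤ c → 4 ℕ.* (c ℕ.* a) ≡ s ℕ.* s ℕ.+ Δ → a ≡ 1
  reduced⇒≡1 {a} {c} {s} 0<a s≤a a≤c eq =
    ℕ.≤-antisym (reduced a<8 (ℕ.≤-<-trans s≤a a<8) s≤a 4a²≤ (ℕ.divides c (trans (sym eq) 4ca≡))) 0<a
    where
    4ca≡ : 4 ℕ.* (c ℕ.* a) ≡ c ℕ.* (4 ℕ.* a)
    4ca≡ = trans (sym (ℕ.*-assoc 4 c a)) (trans (cong (ℕ._* a) (ℕ.*-comm 4 c)) (ℕ.*-assoc c 4 a))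
    4a²≤ : 4 ℕ.* (a ℕ.* a) ℕ.≤ s ℕ.* s ℕ.+ Δ
    4a²≤ = subst (4 ℕ.* (a ℕ.* a) ℕ.≤_) eq (ℕ.*-monoʳ-≤ 4 (ℕ.*-monoˡ-≤ a a≤c))
    3a²≤ : 3 ℕ.* (a ℕ.* a) ℕ.≤ 163
    3a²≤ = ℕ.≤-trans (ℕ.+-cancelˡ-≤ (a ℕ.* a) _ _ (ℕ.≤-trans 4a²≤ (ℕ.+-monoˡ-≤ Δ (ℕ.*-mono-≤ s≤a s≤a)))) Δ≤163
    a<8 : a ℕ.< 8
    a<8 = ℕ.≰⇒> λ 8≤a → ℕ.<⇒≱ (from-yes (163 ℕ.<? 192)) (ℕ.≤-trans (ℕ.*-monoʳ-≤ 3 (ℕ.*-mono-≤ 8≤a 8≤a)) 3a²≤)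

  -- Adding `a k` to `r` changes `2r + τ` by a multiple of `2a`. Dividing `2r + τ + a` instead of
  -- `2r + τ` moves the range of the remainder from `[0, 2a)` to `[-a, a)`.
  centre : ∀ a → 0 ℕ.< a → ∀ r → ∃ λ k → ℤ.∣ re₂ (θ {d} (r ℤ.+ + a ℤ.* k)) ∣ ℕ.≤ a
  centre a@(suc _) _ r = ℤ.- q , subst (ℕ._≤ a) (cong ℤ.∣_∣ eq) (∣m⊖n∣≤n m a
    (subst (m ℕ.≤_) (cong (a ℕ.+_) (ℕ.+-identityʳ a)) (ℕ.<⇒≤ (ℤ.n%ℕd<d t (2 ℕ.* a)))))
    where
    t = + 2 ℤ.* r ℤ.+ τ d ℤ.+ + a
    m = t ℤ.%ℕ (2 ℕ.* a)
    q = t ℤ./ℕ (2 ℕ.* a)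
    eq : m ℤ.⊖ a ≡ re₂ (θ {d} (r ℤ.+ + a ℤ.* (ℤ.- q)))
    eq = begin
      m ℤ.⊖ a                                   ≡⟨ ℤ.m-n≡m⊖n m a ⟨
      + m ℤ.- + a
        ≡⟨ solve 3 (λ m a q → m :- a := (m :+ q :* (con (+ 2) :* a)) :- q :* (con (+ 2) :* a) :- a) refl (+ m) (+ a) q ⟩
      (+ m ℤ.+ q ℤ.* (+ 2 ℤ.* + a)) ℤ.- q ℤ.* (+ 2 ℤ.* + a) ℤ.- + a
        ≡⟨ cong (λ x → (+ m ℤ.+ q ℤ.* x) ℤ.- q ℤ.* (+ 2 ℤ.* + a) ℤ.- + a) (ℤ.pos-* 2 a) ⟨
      (+ m ℤ.+ q ℤ.* + (2 ℕ.* a)) ℤ.- q ℤ.* (+ 2 ℤ.* + a) ℤ.- + a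
        ≡⟨ cong (λ x → x ℤ.- q ℤ.* (+ 2 ℤ.* + a) ℤ.- + a) (ℤ.a≡a%ℕn+[a/ℕn]*n t (2 ℕ.* a)) ⟨
      t ℤ.- q ℤ.* (+ 2 ℤ.* + a) ℤ.- + a
        ≡⟨ solve 4 (λ r t a q → con (+ 2) :* r :+ t :+ a :- q :* (con (+ 2) :* a) :- a
             := con (+ 2) :* (r :+ a :* (:- q)) :+ t :* con 1ℤ) refl r (τ d) (+ a) q ⟩
      re₂ (θ {d} (r ℤ.+ + a ℤ.* (ℤ.- q))) ∎

  -- When `a` divides `norm (θ r)`, such a `g` is a generator of the ideal `(a, θ r)`.
  HasDivisor : ℕ → ℤ → Set
  HasDivisor a r = ∃ λ g → norm g ≡ a × g ∣ θ {d} r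

  -- If `q * h` is the negated conjugate of `θ r`, then conjugating back gives `θ r` as `- conj q`
  -- times `conj h`. The second factor has norm `c`, which leaves norm `a` for the first.
  codivisor : ∀ {a c} r → norm (θ {d} r) ≡ c ℕ.* a → HasDivisor c (ℤ.- (r ℤ.+ τ d)) → HasDivisor a r
  codivisor {a} {c} r eq (h , norm-h , divides q qh≡) =
    - conj q , norm-g , divides (conj h) (trans (*-comm (conj h) (- conj q)) g*h)
    where
    g*h : (- conj q) * conj h ≡ θ r
    g*h = trans (sym (-conj-* q h)) (trans (cong (λ z → - conj z) (trans qh≡ (sym (θ-conj {d} r)))) (-conj-involutive (θ r)))
    c≢0 : c ≢ 0
    c≢0 c≡0 = θ≢0 {d} r (norm≡0⇒≡0 d<0 (θ r) (trans eq (cong (ℕ._* a) c≡0)))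
    norm-g : norm (- conj q) ≡ a
    norm-g = ℕ.*-cancelˡ-≡ _ a c {{ℕ.≢-nonZero c≢0}} (begin
      c ℕ.* norm (- conj q)                ≡⟨ ℕ.*-comm c _ ⟩
      norm (- conj q) ℕ.* c                ≡⟨ cong (norm (- conj q) ℕ.*_) (trans (norm-conj h) norm-h) ⟨
      norm (- conj q) ℕ.* norm (conj h)    ≡⟨ norm-* (- conj q) (conj h) ⟨
      norm ((- conj q) * conj h)           ≡⟨ cong norm g*h ⟩
      norm (θ {d} r)                       ≡⟨ eq ⟩
      c ℕ.* a                              ∎)

  -- `g` divides its own norm `a`, hence also the difference `a k` of the two elements.
  translate : ∀ {a} r k → HasDivisor a r → HasDivisor a (r ℤ.+ + a ℤ.* k)
  translate {a} r k (g , norm-g , g∣) = g , norm-g , subst (g ∣_) (θ-+ {d} r (+ a) k)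
    (∣-+ g∣ (∣ʳ-trans (subst (λ n → g ∣ fromℤ (+ n)) norm-g (∣-norm d<0 g)) (x∣xy (fromℤ (+ a)) (fromℤ k))))

  -- Gauss reduction of the form (a, 2r + τ, c) with a c = norm (θ r): translate r so that
  -- |2r + τ| ≤ a, and exchange a and c as long as c < a.
  ∣norm-θ⇒hasDivisor : ∀ a → 0 ℕ.< a → ∀ r → a ℕ.∣ norm {d} (θ r) → HasDivisor a r
  ∣norm-θ⇒hasDivisor = ℕ.<-rec P step
    where
    P : ℕ → Set
    P a = 0 ℕ.< a → ∀ r → a ℕ.∣ norm {d} (θ r) → HasDivisor a r

    centred : ∀ {a} → (∀ {c} → c ℕ.< a → P c) → 0 ℕ.< a → ∀ r → ℤ.∣ re₂ (θ {d} r) ∣ ℕ.≤ a →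
              ∀ c → norm (θ {d} r) ≡ c ℕ.* a → Dec (c ℕ.< a) → HasDivisor a r
    -- Here `|2r + τ| ≤ a ≤ c`: the form is reduced, so `a` is 1 and `1#` serves as divisor.
    centred {a} rec 0<a r s≤a c eq (no c≮a) = 1# , trans (norm-1# {d}) (sym a≡1) , divides (θ r) (*-identityʳ (θ r))
      where
      a≡1 = reduced⇒≡1 0<a s≤a (ℕ.≮⇒≥ c≮a) (trans (cong (4 ℕ.*_) (sym eq))
        (trans (4*norm (θ r)) (cong (ℤ.∣ re₂ (θ {d} r) ∣ ℕ.* ℤ.∣ re₂ (θ {d} r) ∣ ℕ.+_) (ℕ.*-identityʳ Δ))))
    centred {a} rec 0<a r s≤a c eq (yes c<a) = codivisor {a} {c} r eq
      (rec c<a (ℕ.n≢0⇒n>0 c≢0) (ℤ.- (r ℤ.+ τ d)) (ℕ.divides a (trans (norm-θ-conj {d} r) (trans eq (ℕ.*-comm c a)))))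
      where
      c≢0 : c ≢ 0
      c≢0 c≡0 = θ≢0 {d} r (norm≡0⇒≡0 d<0 (θ r) (trans eq (cong (ℕ._* a) c≡0)))

    step : ∀ a → (∀ {c} → c ℕ.< a → P c) → P a
    step a rec 0<a r a∣ =
      let k , s≤a = centre a 0<a r
          r′ = r ℤ.+ + a ℤ.* k
          ℕ.divides c eq = subst (λ z → a ℕ.∣ norm z) (θ-+ {d} r (+ a) k) (norm-+-* a (θ {d} r) (fromℤ k) a∣)
      in subst (HasDivisor a) (solve 3 (λ r a k → r :+ a :* k :+ a :* (:- k) := r) refl r (+ a) k)
           (translate r′ (ℤ.- k) (centred rec 0<a r′ s≤a c eq (c ℕ.<? a)))

-- Primary elements above the rational primes

module _ {d : ℤ} where

  -- Unlike `Euclidean`, `Primary` passes from a prime element to its square; coprime factors are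
  -- the only ones met in unitary factorizations.
  Euclidean Primary : 𝒪 d → Set
  Euclidean π = ∀ x y → π ∣ x * y → π ∣ x ⊎ π ∣ y
  Primary   ρ = ∀ x y → Coprime x y → ρ ∣ x * y → ρ ∣ x ⊎ ρ ∣ y

  euclid² : ∀ {p} → Prime p → ∀ i → p ℕ.∣ norm {d} (fromℤ i) → p ℕ.∣ ℤ.∣ i ∣
  euclid² {p} p-prime i p∣ = ⊎.[ id , id ]
    (ℕ.euclidsLemma ℤ.∣ i ∣ ℤ.∣ i ∣ p-prime (subst (p ℕ.∣_) (norm-fromℤ {d} i) p∣))

  module _ (d<0 : d ℤ.< 0ℤ) where

    -- Cancelling one `π` from `π * π ∣ (x′ * π) * y` leaves `π ∣ x′ * y`, and `π` does not divide
    -- `y`, so it divides `x′`.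
    square-∣-factor : ∀ {π} → π ≢ 0# → Euclidean π → ∀ x y → ¬ (π ∣ y) → π ∣ x → π * π ∣ x * y → π * π ∣ x
    square-∣-factor {π} π≢0 π-euclidean x y π∤y (divides x′ x′π≡x) (divides q e) =
      π∣x′⇒ (⊎.fromInj₁ (λ π∣y → contradiction π∣y π∤y) (π-euclidean x′ y (divides q
        (*-cancelʳ d<0 (q * π) (x′ * y) π π≢0 (begin
          (q * π) * π   ≡⟨ *-assoc q π π ⟩
          q * (π * π)   ≡⟨ e ⟩
          x * y         ≡⟨ cong (_* y) x′π≡x ⟨
          (x′ * π) * y  ≡⟨ *-assoc x′ π y ⟩
          x′ * (π * y)  ≡⟨ cong (x′ *_) (*-comm π y) ⟩
          x′ * (y * π)  ≡⟨ *-assoc x′ y π ⟨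
          (x′ * y) * π  ∎)))))
      where
      π∣x′⇒ : π ∣ x′ → π * π ∣ x
      π∣x′⇒ (divides x″ x″π≡x′) = divides x″ (trans (sym (*-assoc x″ π π)) (trans (cong (_* π) x″π≡x′) x′π≡x))

    -- Some factor is divisible by `π`; by coprimality the other is not, so both copies of `π` fall
    -- to the same factor.
    Euclidean⇒square-Primary : ∀ {π} → π ≢ 0# → ¬ (π ∣ 1#) → Euclidean π → Primary (π * π)
    Euclidean⇒square-Primary {π} π≢0 π∤1 π-euclidean x y c ππ∣xy
      with π-euclidean x y (∣ʳ-trans (x∣xy π π) ππ∣xy)
    ... | inj₁ π∣x = inj₁ (square-∣-factor π≢0 π-euclidean x y (λ π∣y → π∤1 (c π∣x π∣y)) π∣x ππ∣xy)
    ... | inj₂ π∣y = inj₂ (square-∣-factor π≢0 π-euclidean y x (λ π∣x → π∤1 (c π∣x π∣y)) π∣y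
                            (subst (π * π ∣_) (*-comm x y) ππ∣xy))

    -- Reduction modulo a prime dividing θ r, which sends ω to - r.
    residue : ℤ → 𝒪 d → ℤ
    residue r x = rat x ℤ.- coef x ℤ.* r

    residue-split : ∀ r x → fromℤ (residue r x) + θ r * fromℤ (coef x) ≡ x
    residue-split r ⟨ a , b ⟩ = cong₂ ⟨_,_⟩
      (solve 4 (λ a b r k → a :- b :* r :+ (r :* b :+ k :* (con 1ℤ :* con 0ℤ)) := a) refl a b r (κ d))
      (solve 3 (λ b r t → con 0ℤ :+ (r :* con 0ℤ :+ con 1ℤ :* b :+ t :* (con 1ℤ :* con 0ℤ)) := b) refl b r (τ d))

    residue-split′ : ∀ r x → x + θ r * fromℤ (ℤ.- coef x) ≡ fromℤ (residue r x)
    residue-split′ r ⟨ a , b ⟩ = cong₂ ⟨_,_⟩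
      (solve 4 (λ a b r k → a :+ (r :* (:- b) :+ k :* (con 1ℤ :* con 0ℤ)) := a :- b :* r) refl a b r (κ d))
      (solve 3 (λ b r t → b :+ (r :* con 0ℤ :+ con 1ℤ :* (:- b) :+ t :* (con 1ℤ :* con 0ℤ)) := con 0ℤ) refl b r (τ d))

    -- Replacing `ω` by `-r` respects `ω² = τ ω + κ` only up to `r² + τ r - κ`, which is the norm of
    -- `θ r`; hence the correction term.
    residue-* : ∀ r x y → residue r (x * y) ℤ.+ rat (θ {d} r * conj (θ r)) ℤ.* (coef x ℤ.* coef y) ≡ residue r x ℤ.* residue r y
    residue-* r ⟨ a , b ⟩ ⟨ c , e ⟩ = solve 7 (λ a b c e r t k →
      (a :* c :+ k :* (b :* e)) :- (a :* e :+ b :* c :+ t :* (b :* e)) :* r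
        :+ (r :* (r :+ t :* con 1ℤ) :+ k :* (con 1ℤ :* (:- con 1ℤ))) :* (b :* e)
      := (a :- b :* r) :* (c :- e :* r)) refl a b c e r (τ d) (κ d)

    module _ {p : ℕ} {π : 𝒪 d} {r : ℤ} (p-prime : Prime p) (norm-π : norm π ≡ p) (π∣θ : π ∣ θ r) where

      private
        -- `x` and its residue differ by a multiple of `θ r`, so `π` divides the residue. Taking
        -- norms, `p` divides the square of this rational integer.
        ∣⇒∣residue : ∀ x → π ∣ x → + p Signed.∣ residue r x
        ∣⇒∣residue x π∣x = Signed.∣ᵤ⇒∣ {+ p} (euclid² p-prime (residue r x) (subst (ℕ._∣ norm {d} (fromℤ (residue r x))) norm-π
          (norm-mono-∣ (subst (π ∣_) (residue-split′ r x) (∣-+ π∣x (∣ʳ-trans π∣θ (x∣xy (θ r) (fromℤ (ℤ.- coef x)))))))))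

        ∣residue⇒∣ : ∀ x → p ℕ.∣ ℤ.∣ residue r x ∣ → π ∣ x
        ∣residue⇒∣ x p∣ = subst (π ∣_) (residue-split r x) (∣-+ (π∣ (Signed.∣ᵤ⇒∣ {+ p} {residue r x} p∣)) (∣ʳ-trans π∣θ (x∣xy (θ r) (fromℤ (coef x)))))
          where
          π∣ : ∀ {i} → + p Signed.∣ i → π ∣ fromℤ i
          π∣ {i} (Signed.divides q i≡qp) = ∣ʳ-trans (subst (λ n → π ∣ fromℤ (+ n)) norm-π (∣-norm d<0 π))
            (divides (fromℤ q) (trans (fromℤ-* q (fromℤ (+ p))) (cong₂ ⟨_,_⟩ (sym i≡qp) (ℤ.*-zeroʳ q))))

      -- `π` divides exactly the elements whose residue vanishes modulo `p`, and residues are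
      -- multiplicative modulo `p`. Euclid's lemma in the integers therefore carries over.
      norm-prime⇒Euclidean : Euclidean π
      norm-prime⇒Euclidean x y π∣xy = ⊎.map (∣residue⇒∣ x) (∣residue⇒∣ y)
        (ℕ.euclidsLemma _ _ p-prime (subst (p ℕ.∣_) (ℤ.abs-* (residue r x) (residue r y)) (Signed.∣⇒∣ᵤ
          (subst (+ p Signed.∣_) (residue-* r x y) (Signed.∣m∣n⇒∣m+n (∣⇒∣residue (x * y) π∣xy)
            (Signed.∣m⇒∣m*n (coef x ℤ.* coef y) (Signed.∣ᵤ⇒∣ {+ p} {rat (θ {d} r * conj (θ r))}
              (subst (ℕ._∣ norm {d} (θ r)) norm-π (norm-mono-∣ π∣θ)))))))))

  -- Bézout for `p` and `|b|`, with the sign of `b` absorbed by `s`; one of the two shapes of the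
  -- identity calls for negated witnesses.
  inverse-mod : ∀ {p} → Prime p → ∀ b → ¬ (p ℕ.∣ ℤ.∣ b ∣) → ∃ λ c → ∃ λ k → c ℤ.* b ≡ 1ℤ ℤ.+ + p ℤ.* k
  inverse-mod {p} p-prime b p∤b = go ∣b∣≡±b (ℕ.coprime-Bézout coprime)
    where
    coprime : ℕ.Coprime p ℤ.∣ b ∣
    coprime {m} (m∣p , m∣b) with ℕ.prime⇒irreducible p-prime m∣p
    ... | inj₁ m≡1  = m≡1
    ... | inj₂ refl = contradiction m∣b p∤b
    ∣b∣≡±b : ∃ λ s → + ℤ.∣ b ∣ ≡ s ℤ.* b
    ∣b∣≡±b with ℤ.+∣i∣≡i⊎+∣i∣≡-i b
    ... | inj₁ e = 1ℤ , trans e (sym (ℤ.*-identityˡ b))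
    ... | inj₂ e = ℤ.-1ℤ , trans e (sym (ℤ.-1*i≡-i b))
    lift : ∀ {m n} y x → 1 ℕ.+ x ℕ.* m ≡ y ℕ.* n → 1ℤ ℤ.+ + x ℤ.* + m ≡ + y ℤ.* + n
    lift {m} {n} y x eq = trans (cong (λ i → 1ℤ ℤ.+ i) (sym (ℤ.pos-* x m))) (trans (cong +_ eq) (ℤ.pos-* y n))
    go : (∃ λ s → + ℤ.∣ b ∣ ≡ s ℤ.* b) → Bézout.Identity 1 p ℤ.∣ b ∣ → ∃ λ c → ∃ λ k → c ℤ.* b ≡ 1ℤ ℤ.+ + p ℤ.* k
    go (s , eq) (Bézout.-+ x y e) = + y ℤ.* s , + x , (begin
      + y ℤ.* s ℤ.* b       ≡⟨ ℤ.*-assoc (+ y) s b ⟩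
      + y ℤ.* (s ℤ.* b)     ≡⟨ cong (+ y ℤ.*_) eq ⟨
      + y ℤ.* + ℤ.∣ b ∣     ≡⟨ lift y x e ⟨
      1ℤ ℤ.+ + x ℤ.* + p    ≡⟨ cong (λ i → 1ℤ ℤ.+ i) (ℤ.*-comm (+ x) (+ p)) ⟩
      1ℤ ℤ.+ + p ℤ.* + x    ∎)
    go (s , eq) (Bézout.+- x y e) = ℤ.- (+ y ℤ.* s) , ℤ.- + x , (begin
      ℤ.- (+ y ℤ.* s) ℤ.* b       ≡⟨ solve 3 (λ y s b → (:- (y :* s)) :* b := con 1ℤ :- (con 1ℤ :+ y :* (s :* b))) refl (+ y) s b ⟩
      1ℤ ℤ.- (1ℤ ℤ.+ + y ℤ.* (s ℤ.* b)) ≡⟨ cong (λ i → 1ℤ ℤ.- i) (trans (cong (λ i → 1ℤ ℤ.+ + y ℤ.* i) (sym eq)) (lift x y e)) ⟩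
      1ℤ ℤ.- + x ℤ.* + p          ≡⟨ solve 2 (λ x p → con 1ℤ :- x :* p := con 1ℤ :+ p :* (:- x)) refl (+ x) (+ p) ⟩
      1ℤ ℤ.+ + p ℤ.* (ℤ.- + x)    ∎)

  module _ {p : ℕ} (p-prime : Prime p) (no-root : ¬ (∃ λ (r : ℕ) → r ℕ.< p × p ℕ.∣ norm {d} (θ (+ r)))) where

    private
      instance
        p≢0 : ℕ.NonZero p
        p≢0 = ℕ.prime⇒nonZero p-prime

      -- Modulo `p` the norm of `θ r` depends only on the remainder of `r`, so the search below `p`
      -- speaks for all integers.
      ∤norm-θ : ∀ r → ¬ (p ℕ.∣ norm {d} (θ r))
      ∤norm-θ r p∣ = no-root (r ℤ.%ℕ p , ℤ.n%ℕd<d r p ,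
        subst (λ i → p ℕ.∣ norm {d} i) (trans (θ-+ {d} r (+ p) (ℤ.- (r ℤ./ℕ p))) (cong (θ {d}) (eq {+ (r ℤ.%ℕ p)} {r ℤ./ℕ p} (ℤ.a≡a%ℕn+[a/ℕn]*n r p))))
          (norm-+-* p (θ {d} r) (fromℤ (ℤ.- (r ℤ./ℕ p))) p∣))
        where
        eq : ∀ {m q} → r ≡ m ℤ.+ q ℤ.* + p → r ℤ.+ + p ℤ.* (ℤ.- q) ≡ m
        eq {m} {q} r≡ = trans (cong (λ i → i ℤ.+ + p ℤ.* (ℤ.- q)) r≡)
          (solve 3 (λ m q p → m :+ q :* p :+ p :* (:- q) := m) refl m q (+ p))

      -- Otherwise multiply `x = a + b ω` by an inverse `c` of `b` modulo `p`: the result is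
      -- congruent to `θ (c a)`, whose norm would then be divisible by `p`.
      ∣norm⇒∣coef : ∀ x → p ℕ.∣ norm {d} x → p ℕ.∣ ℤ.∣ coef x ∣
      ∣norm⇒∣coef x@(⟨ a , b ⟩) p∣ with p ℕ.∣? ℤ.∣ b ∣
      ... | yes p∣b = p∣b
      ... | no  p∤b =
        let c , k , cb≡1+pk = inverse-mod p-prime b p∤b
        in contradiction
          (subst (λ z → p ℕ.∣ norm z)
            (trans (cong₂ _+_ (fromℤ-* c x) (fromℤ-* (+ p) ⟨ 0ℤ , ℤ.- k ⟩)) (cong₂ ⟨_,_⟩
              (solve 2 (λ i p → i :+ p :* con 0ℤ := i) refl (c ℤ.* a) (+ p))
              (trans (cong (λ i → i ℤ.+ + p ℤ.* (ℤ.- k)) cb≡1+pk)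
                (solve 2 (λ p k → con 1ℤ :+ p :* k :+ p :* (:- k) := con 1ℤ) refl (+ p) k))))
            (norm-+-* p (fromℤ c * x) ⟨ 0ℤ , ℤ.- k ⟩
              (subst (p ℕ.∣_) (sym (norm-* (fromℤ c) x)) (ℕ.∣n⇒∣m*n (norm {d} (fromℤ c)) p∣))))
          (∤norm-θ (c ℤ.* a))

      -- Once `p` divides `b`, `x` is congruent to the integer `a`, so `p` divides `a²` and hence
      -- `a`.
      ∣norm⇒∣ : ∀ x → p ℕ.∣ norm {d} x → fromℤ (+ p) ∣ x
      ∣norm⇒∣ x@(⟨ a , b ⟩) p∣ =
        let Signed.divides u b≡up = Signed.∣ᵤ⇒∣ {+ p} (∣norm⇒∣coef x p∣)
            Signed.divides v a≡vp = Signed.∣ᵤ⇒∣ {+ p} (euclid² p-prime a (subst (λ z → p ℕ.∣ norm z)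
              (trans (cong (λ z → x + z) (fromℤ-* (+ p) ⟨ 0ℤ , ℤ.- u ⟩)) (cong₂ ⟨_,_⟩
                (solve 2 (λ i p → i :+ p :* con 0ℤ := i) refl a (+ p))
                (trans (cong (λ i → i ℤ.+ + p ℤ.* (ℤ.- u)) b≡up)
                  (solve 2 (λ p k → k :* p :+ p :* (:- k) := con 0ℤ) refl (+ p) u))))
              (norm-+-* p x ⟨ 0ℤ , ℤ.- u ⟩ p∣)))
        in divides ⟨ v , u ⟩ (trans (*-comm ⟨ v , u ⟩ (fromℤ (+ p))) (trans (fromℤ-* (+ p) ⟨ v , u ⟩)
             (cong₂ ⟨_,_⟩ (trans (ℤ.*-comm (+ p) v) (sym a≡vp)) (trans (ℤ.*-comm (+ p) u) (sym b≡up)))))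

    -- Divisibility by `p` can be read off the norm here, and the norm is multiplicative, so
    -- Euclid's lemma is applied to the norms.
    no-root⇒Euclidean : Euclidean (fromℤ {d} (+ p))
    no-root⇒Euclidean x y p∣xy = ⊎.map (∣norm⇒∣ x) (∣norm⇒∣ y)
      (ℕ.euclidsLemma (norm x) (norm y) p-prime (subst (p ℕ.∣_) (norm-* x y)
        (ℕ.∣-trans (subst (p ℕ.∣_) (sym (norm-fromℤ {d} (+ p))) (ℕ.m∣m*n p)) (norm-mono-∣ p∣xy))))

  -- Split and ramified primes are treated alike. For split `p` the square of `π` is taken, because
  -- `p` itself is a product of two coprime nonunits and so is not `Primary`.
  primaryAbove : d ℤ.< 0ℤ → ClassNumberOne d → ∀ {p} → Prime p → ∃ λ ρ → norm {d} ρ ≡ p ℕ.* p × Primary ρ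
  primaryAbove d<0 h {p} p-prime with ℕ.anyUpTo? (λ r → p ℕ.∣? norm {d} (θ (+ r))) p
  ... | no  no-root = fromℤ (+ p) , norm-fromℤ {d} (+ p) , λ x y _ → no-root⇒Euclidean p-prime no-root x y
  ... | yes (r , _ , p∣) =
    let π , norm-π , π∣θ = ∣norm-θ⇒hasDivisor d<0 h p (ℕ.>-nonZero⁻¹ p {{ℕ.prime⇒nonZero p-prime}}) (+ r) p∣
    in π * π , trans (norm-* π π) (cong₂ ℕ._*_ norm-π norm-π) ,
       Euclidean⇒square-Primary d<0
         (λ π≡0 → ℕ.≢-nonZero⁻¹ p {{ℕ.prime⇒nonZero p-prime}} (trans (sym norm-π) (trans (cong norm π≡0) (norm-fromℤ {d} 0ℤ))))
         (λ π∣1 → ℕ.nonTrivial⇒≢1 {{ℕ.prime⇒nonTrivial p-prime}} (trans (sym norm-π) (∣1⇒norm≡1 π∣1)))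
         (norm-prime⇒Euclidean d<0 p-prime norm-π π∣θ)

-- Unitary factorizations

module _ {d : ℤ} where

  open CommutativeRing (𝒪-commutativeRing d) public using (*-isCommutativeMonoid)
  open RawMagmaDefinitions (CommutativeRing.*-rawMagma (𝒪-commutativeRing d)) public using (_∥_)
  open SemigroupDivisibility (CommutativeRing.*-commutativeSemigroup (𝒪-commutativeRing d)) public
    using (∙-cong-∣; ∥-sym; ∥-trans)

  ∥-*-cong : {x y u v : 𝒪 d} → x ∥ y → u ∥ v → x * u ∥ y * v
  ∥-*-cong (p , q) (r , s) = ∙-cong-∣ p r , ∙-cong-∣ q s

  norm-cong-∥ : {x y : 𝒪 d} → x ∥ y → norm x ≡ norm y
  norm-cong-∥ (p , q) = ℕ.∣-antisym (norm-mono-∣ p) (norm-mono-∣ q)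

  ≡⇒∥ : {x y : 𝒪 d} → x ≡ y → x ∥ y
  ≡⇒∥ refl = ∣ʳ-refl , ∣ʳ-refl

  module _ (d<0 : d ℤ.< 0ℤ) where

    ∣-cancelʳ : (x y z : 𝒪 d) → z ≢ 0# → x * z ∣ y * z → x ∣ y
    ∣-cancelʳ x y z z≢0 (divides q e) = divides q (*-cancelʳ d<0 (q * x) y z z≢0 (trans (*-assoc q x z) e))

    ∥-cancelʳ : (x y z : 𝒪 d) → z ≢ 0# → x * z ∥ y * z → x ∥ y
    ∥-cancelʳ x y z z≢0 (p , q) = ∣-cancelʳ x y z z≢0 p , ∣-cancelʳ y x z z≢0 q

    coprime-norm⇒Coprime : {x y : 𝒪 d} → ℕ.Coprime (norm x) (norm y) → Coprime x y
    coprime-norm⇒Coprime c u∣x u∣y = norm≡1⇒∣1 d<0 (c (norm-mono-∣ u∣x , norm-mono-∣ u∣y))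

coprime-squares : ∀ {m n} → ℕ.Coprime m n → ℕ.Coprime (m ℕ.* m) (n ℕ.* n)
coprime-squares c = square (ℕ.sym (square (ℕ.sym c)))
  where
  square : ∀ {m n} → ℕ.Coprime m n → ℕ.Coprime (m ℕ.* m) n
  square {m} {n} c {i} (i∣mm , i∣n) = c (ℕ.coprime-divisor (λ (j∣i , j∣m) → c (j∣m , ℕ.∣-trans j∣i i∣n)) i∣mm , i∣n)

module _ {d : ℤ} (d<0 : d ℤ.< 0ℤ) (h : ClassNumberOne d) where

  ρ : ℕ → 𝒪 d
  ρ p with ℕ.prime? p
  ... | yes p-prime = proj₁ (primaryAbove d<0 h p-prime)
  -- A default value: `ρ` is meant for prime factors only.
  ... | no  _       = 1#

  norm-ρ : ∀ {p} → Prime p → norm (ρ p) ≡ p ℕ.* p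
  norm-ρ {p} p-prime with ℕ.prime? p
  ... | yes q = proj₁ (proj₂ (primaryAbove d<0 h q))
  ... | no ¬q = contradiction p-prime ¬q

  ρ-primary : ∀ {p} → Prime p → Primary (ρ p)
  ρ-primary {p} p-prime with ℕ.prime? p
  ... | yes q = proj₂ (proj₂ (primaryAbove d<0 h q))
  ... | no ¬q = contradiction p-prime ¬q

  Πρ : List ℕ → 𝒪 d
  Πρ ps = foldr _*_ 1# (map ρ ps)

  Πρ-++ : ∀ ps qs → Πρ (ps ++ qs) ≡ Πρ ps * Πρ qs
  Πρ-++ []       qs = sym (*-identityˡ (Πρ qs))
  Πρ-++ (p ∷ ps) qs = trans (cong (ρ p *_) (Πρ-++ ps qs)) (sym (*-assoc (ρ p) (Πρ ps) (Πρ qs)))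

  Πρ-↭ : ∀ {ps qs} → ps ↭ qs → Πρ ps ≡ Πρ qs
  Πρ-↭ p = ↭ₛ.foldr-commMonoid (setoid (𝒪 d)) *-isCommutativeMonoid (↭⇒↭ₛ (↭.map⁺ ρ p))

  norm-Πρ : ∀ {ps} → All Prime ps → norm (Πρ ps) ≡ product ps ℕ.* product ps
  norm-Πρ [] = norm-1# {d}
  norm-Πρ {p ∷ ps} (p-prime ∷ ps-prime) = begin
    norm (ρ p * Πρ ps)                                ≡⟨ norm-* (ρ p) (Πρ ps) ⟩
    norm (ρ p) ℕ.* norm (Πρ ps)                       ≡⟨ cong₂ ℕ._*_ (norm-ρ p-prime) (norm-Πρ ps-prime) ⟩
    p ℕ.* p ℕ.* (product ps ℕ.* product ps)           ≡⟨ ℕ.[m*n]*[o*p]≡[m*o]*[n*p] p p (product ps) (product ps) ⟩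
    p ℕ.* product ps ℕ.* (p ℕ.* product ps)           ∎

  -- The value at zero keeps `lift` multiplicative, and its norm equal to `n²`, on all of `ℕ`.
  lift : ℕ → 𝒪 d
  lift zero      = 0#
  lift n@(suc _) = Πρ (factors (factorise n))

  -- Prime factorisations of `n` agree up to order, which `Πρ` ignores. Any convenient factorisation
  -- may thus replace the computed one.
  lift-factorisation : ∀ {n} → (f : PrimeFactorisation n) → lift n ≡ Πρ (factors f)
  lift-factorisation {zero}  f = contradiction (isFactorisation f) (ℕ.<⇒≢ (ℕ.productOfPrimes≥1 (factorsPrime f)))
  lift-factorisation {suc n} f = Πρ-↭ (factorisationUnique (factorise (suc n)) f)

  lift-product : ∀ {ps} → All Prime ps → lift (product ps) ≡ Πρ ps
  lift-product ps-prime = lift-factorisation record { isFactorisation = refl ; factorsPrime = ps-prime }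

  lift-* : ∀ m n → lift (m ℕ.* n) ≡ lift m * lift n
  lift-* zero n = sym (zeroˡ (lift n))
  lift-* m@(suc _) zero = trans (cong lift (ℕ.*-zeroʳ m)) (sym (zeroʳ (lift m)))
  lift-* m@(suc _) n@(suc _) = trans (lift-factorisation record
    { isFactorisation = trans (cong₂ ℕ._*_ (isFactorisation fm) (isFactorisation fn)) (sym (product-++ (factors fm) (factors fn)))
    ; factorsPrime = All.++⁺ (factorsPrime fm) (factorsPrime fn)
    }) (Πρ-++ (factors fm) (factors fn))
    where
    fm = factorise m
    fn = factorise n

  lift-prime-* : ∀ {p} → Prime p → ∀ n → lift (p ℕ.* n) ≡ lift n * ρ p
  lift-prime-* {p} p-prime n = trans (lift-* p n) (trans (*-comm (lift p) (lift n)) (cong (lift n *_)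
    (trans (cong lift (sym (ℕ.*-identityʳ p))) (trans (lift-product (p-prime ∷ [])) (*-identityʳ (ρ p))))))

  lift-mono-∣ : ∀ {m n} → m ℕ.∣ n → lift m ∣ lift n
  lift-mono-∣ {m} (ℕ.divides q refl) = divides (lift q) (sym (lift-* q m))

  norm-lift : ∀ n → norm (lift n) ≡ n ℕ.* n
  norm-lift zero      = norm-fromℤ {d} 0ℤ
  norm-lift n@(suc _) = trans (norm-Πρ (factorsPrime f)) (cong₂ ℕ._*_ n≡ n≡)
    where
    f = factorise n
    n≡ = sym (isFactorisation f)

  lift≢0 : ∀ {n} → 0 ℕ.< n → lift n ≢ 0#
  lift≢0 {suc n} _ eq with trans (sym (norm-lift (suc n))) (trans (cong norm eq) (norm-fromℤ {d} 0ℤ))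
  ... | ()

  ρ≢0 : ∀ {p} → Prime p → ρ p ≢ 0#
  ρ≢0 {p} p-prime ρ≡0 = ℕ.≢-nonZero⁻¹ (p ℕ.* p) {{ℕ.m*n≢0 p p {{p≢0}} {{p≢0}}}}
    (trans (sym (norm-ρ p-prime)) (trans (cong norm ρ≡0) (norm-fromℤ {d} 0ℤ)))
    where p≢0 = ℕ.prime⇒nonZero p-prime

  Splits : ℕ → 𝒪 d → 𝒪 d → Set
  Splits n x y = ∃ λ c → ∃ λ c′ → c ℕ.* c′ ≡ n × x ∥ lift c × y ∥ lift c′

  -- Induction on the primes: `ρ p` divides `x` or `y` because it is `Primary`; cancel it there,
  -- apply the induction hypothesis and put `p` back into the matching factor of `n`. With no primes
  -- left, `x` and `y` are units.
  coprime-factors⇒Splits : ∀ {ps} → All Prime ps → ∀ x y → Coprime x y → x * y ∥ lift (product ps) → Splits (product ps) x y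
  coprime-factors⇒Splits [] x y _ (xy∣1 , _) = 1 , 1 , refl , unit (∣ʳ-trans (x∣xy x y) xy∣1) , unit (∣ʳ-trans (x∣ʳyx y x) xy∣1)
    where
    unit : ∀ {u} → u ∣ 1# → u ∥ lift 1
    unit {u} u∣1 = u∣1 , divides u (*-identityʳ u)
  coprime-factors⇒Splits {p ∷ ps} (p-prime ∷ ps-prime) x y c xy∥ =
    ⊎.[ (λ ρ∣x → extend x y c xy∥ ρ∣x)
      , (λ ρ∣y → swap (extend y x (λ u∣y u∣x → c u∣x u∣y) (∥-trans (≡⇒∥ (*-comm y x)) xy∥) ρ∣y))
      ] (ρ-primary p-prime x y c (∣ʳ-trans (subst (ρ p ∣_) (sym (lift-prime-* p-prime n)) (x∣ʳyx (ρ p) (lift n))) (proj₂ xy∥)))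
    where
    n = product ps
    swap : ∀ {m x y} → Splits m x y → Splits m y x
    swap (c , c′ , eq , px , py) = c′ , c , trans (ℕ.*-comm c′ c) eq , py , px
    extend : ∀ x y → Coprime x y → x * y ∥ lift (p ℕ.* n) → ρ p ∣ x → Splits (p ℕ.* n) x y
    extend x y c xy∥ (divides x′ x′ρ≡x) =
      let a , a′ , aa′≡n , x′∥ , y∥ = coprime-factors⇒Splits ps-prime x′ y
            (λ u∣x′ → c (subst (_ ∣_) x′ρ≡x (∣ʳ-trans u∣x′ (x∣xy x′ (ρ p)))))
            (∥-cancelʳ d<0 (x′ * y) (lift n) (ρ p) (ρ≢0 p-prime) (∥-trans (≡⇒∥ x′yρ≡xy)
              (∥-trans xy∥ (≡⇒∥ (lift-prime-* p-prime n)))))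
      in p ℕ.* a , a′ , trans (ℕ.*-assoc p a a′) (cong (p ℕ.*_) aa′≡n) ,
         ∥-trans (≡⇒∥ (sym x′ρ≡x)) (∥-trans (∥-*-cong x′∥ (≡⇒∥ refl)) (≡⇒∥ (sym (lift-prime-* p-prime a)))) , y∥
      where
      x′yρ≡xy : (x′ * y) * ρ p ≡ x * y
      x′yρ≡xy = begin
        (x′ * y) * ρ p  ≡⟨ *-assoc x′ y (ρ p) ⟩
        x′ * (y * ρ p)  ≡⟨ cong (x′ *_) (*-comm y (ρ p)) ⟩
        x′ * (ρ p * y)  ≡⟨ *-assoc x′ (ρ p) y ⟨
        (x′ * ρ p) * y  ≡⟨ cong (_* y) x′ρ≡x ⟩
        x * y           ∎

  module _ {n : ℕ} (0<n : 0 ℕ.< n) {z : 𝒪 d} (z∥ : z ∥ lift n) where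

    -- `c` and `c′` are coprime since a common divisor `k` makes `lift k` a common divisor of `x`
    -- and `y`, hence a unit, and its norm is `k²`.
    unitary-factor : ∀ {x y} → y * x ≡ z → Coprime x y → ∃ λ c → ∃ λ c′ → c ℕ.* c′ ≡ n × ℕ.Coprime c c′ × x ∥ lift c
    unitary-factor {x} {y} yx≡z coprime =
      let a , a′ , eq , x∥ , y∥ = coprime-factors⇒Splits (factorsPrime f) x y coprime
            (subst (λ m → x * y ∥ lift m) (isFactorisation f) (∥-trans (≡⇒∥ (trans (*-comm x y) yx≡z)) z∥))
      in a , a′ , trans eq (sym (isFactorisation f)) ,
         (λ {k} (k∣a , k∣a′) → ℕ.m*n≡1⇒m≡1 k k (trans (sym (norm-lift k)) (∣1⇒norm≡1
           (coprime (∣ʳ-trans (lift-mono-∣ k∣a) (proj₂ x∥)) (∣ʳ-trans (lift-mono-∣ k∣a′) (proj₂ y∥)))))) , x∥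
      where f = factorise n {{ℕ.>-nonZero 0<n}}

    -- Comparing norms, the cofactor of `x` has norm `c′²`. This is coprime to `c²`, the norm of
    -- `x`, and elements with coprime norms are coprime.
    unitary-factor⁻¹ : ∀ {c c′ x} → c ℕ.* c′ ≡ n → ℕ.Coprime c c′ → x ∥ lift c → ∃ λ y → y * x ≡ z × Coprime x y
    unitary-factor⁻¹ {c} {c′} {x} cc′≡n coprime x∥ =
      go (∣ʳ-trans (proj₁ x∥) (∣ʳ-trans (lift-mono-∣ (ℕ.divides c′ (trans (sym cc′≡n) (ℕ.*-comm c c′)))) (proj₂ z∥)))
      where
      norm-x : norm x ≡ c ℕ.* c
      norm-x = trans (norm-cong-∥ x∥) (norm-lift c)
      instance
        n≢0 : ℕ.NonZero n
        n≢0 = ℕ.>-nonZero 0<n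
        cc≢0 : ℕ.NonZero (c ℕ.* c)
        cc≢0 = ℕ.m*n≢0 c c {{c≢0}} {{c≢0}}
          where c≢0 = ℕ.m*n≢0⇒m≢0 c {c′} {{subst ℕ.NonZero (sym cc′≡n) n≢0}}
      go : x ∣ z → ∃ λ y → y * x ≡ z × Coprime x y
      go (divides y yx≡z) = y , yx≡z , coprime-norm⇒Coprime d<0
        (subst₂ ℕ.Coprime (sym norm-x) (sym norm-y) (coprime-squares coprime))
        where
        norm-y : norm y ≡ c′ ℕ.* c′
        norm-y = ℕ.*-cancelʳ-≡ _ _ (c ℕ.* c) (begin
          norm y ℕ.* (c ℕ.* c)          ≡⟨ cong (norm y ℕ.*_) norm-x ⟨
          norm y ℕ.* norm x             ≡⟨ norm-* y x ⟨
          norm (y * x)                  ≡⟨ cong norm yx≡z ⟩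
          norm z                        ≡⟨ trans (norm-cong-∥ z∥) (norm-lift n) ⟩
          n ℕ.* n                       ≡⟨ cong (λ m → m ℕ.* m) (trans (sym cc′≡n) (ℕ.*-comm c c′)) ⟩
          c′ ℕ.* c ℕ.* (c′ ℕ.* c)       ≡⟨ ℕ.[m*n]*[o*p]≡[m*o]*[n*p] c′ c c′ c ⟩
          c′ ℕ.* c′ ℕ.* (c ℕ.* c)       ∎)

-- Units and fundamental sectors

-- box 8 contains every element of norm 1, by ∈-box.
units? : ∀ {d} (us : List (𝒪 d)) → Dec (All (λ u → norm u ≡ 1 → u ∈ us) (box 8))
units? us = All.all? (λ u → (norm u ℕ.≟ 1) →-dec any? (u ≟_) us) (box 8)

-- The sector holds exactly one associate of each nonzero element: `rotate` gives existence, and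
-- `rigid` over the complete list of units gives uniqueness.
record FundamentalSector (d : ℤ) : Set where
  field
    units     : List (𝒪 d)
    all-units : All (λ u → norm u ≡ 1 → u ∈ units) (box 8)
    rotate    : ∀ z → z ≢ 0# → ∃ λ u → norm u ≡ 1 × InSector d (u * z)
    rigid     : ∀ z → InSector d z → All (λ u → InSector d (u * z) → u ≡ 1#) units

  module _ (d<0 : d ℤ.< 0ℤ) where

    representative : ∀ z → z ≢ 0# → ∃ λ r → A d r × r ∥ z
    representative z z≢0 with rotate z z≢0
    ... | u , norm-u , sector = u * z , (*-≢0 d<0 u≢0 z≢0 , sector) , uz∣z (norm≡1⇒∣1 d<0 norm-u) , x∣ʳyx z u
      where
      u≢0 : u ≢ 0#
      u≢0 refl = contradiction (trans (sym (norm-fromℤ {d} 0ℤ)) norm-u) λ ()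
      uz∣z : u ∣ 1# → u * z ∣ z
      uz∣z (divides v vu≡1) = divides v (trans (sym (*-assoc v u z)) (trans (cong (_* z) vu≡1) (*-identityˡ z)))

    -- Associates have equal norms, so the quotient `u` has norm 1 and is on the list of units,
    -- where `rigid` leaves only `1#`.
    representative-unique : ∀ {x y} → A d x → A d y → x ∥ y → x ≡ y
    representative-unique {x} {y} (x≢0 , sector-x) (_ , sector-y) x∥y@(divides u ux≡y , _) =
      trans (sym (*-identityˡ x)) (trans (cong (_* x) (sym u≡1)) ux≡y)
      where
      norm-u : norm u ≡ 1
      norm-u = ℕ.*-cancelʳ-≡ _ 1 (norm x) {{ℕ.>-nonZero (norm-pos d<0 x x≢0)}}
        (trans (sym (norm-* u x)) (trans (cong norm ux≡y) (trans (sym (norm-cong-∥ x∥y)) (sym (ℕ.*-identityˡ (norm x))))))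
      u≡1 : u ≡ 1#
      u≡1 = All.lookup (rigid x sector-x) (All.lookup all-units (∈-box d<0 u 1 (ℕ.≤-reflexive norm-u)) norm-u)
        (subst (InSector d) (sym ux≡y) sector-y)

module _ {d : ℤ} where

  HalfPlane : 𝒪 d → Set
  HalfPlane z = 0ℤ ℤ.< im₂ z ⊎ (im₂ z ≡ 0ℤ × 0ℤ ℤ.< re₂ z)

  -1* : ∀ (z : 𝒪 d) → (- 1#) * z ≡ - z
  -1* ⟨ a , b ⟩ = cong₂ ⟨_,_⟩
    (solve 3 (λ a b k → con ℤ.-1ℤ :* a :+ k :* (con 0ℤ :* b) := :- a) refl a b (κ d))
    (solve 3 (λ a b t → con ℤ.-1ℤ :* b :+ con 0ℤ :* a :+ t :* (con 0ℤ :* b) := :- b) refl a b (τ d))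

  re₂-neg : ∀ (z : 𝒪 d) → re₂ (- z) ≡ ℤ.- re₂ z
  re₂-neg ⟨ a , b ⟩ = solve 3 (λ a b t → con (+ 2) :* (:- a) :+ t :* (:- b) := :- (con (+ 2) :* a :+ t :* b)) refl a b (τ d)

  im₂-neg : ∀ (z : 𝒪 d) → im₂ (- z) ≡ ℤ.- im₂ z
  im₂-neg ⟨ a , b ⟩ = solve 2 (λ b t → (con (+ 2) :- t) :* (:- b) := :- ((con (+ 2) :- t) :* b)) refl b (τ d)

  2-τ≢0 : + 2 ℤ.- τ d ≢ 0ℤ
  2-τ≢0 with d ℤ.%ℕ 4
  ... | 0           = λ ()
  ... | 1           = λ ()
  ... | suc (suc _) = λ ()

  re₂≡0∧im₂≡0⇒≡0 : ∀ (z : 𝒪 d) → re₂ z ≡ 0ℤ → im₂ z ≡ 0ℤ → z ≡ 0#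
  re₂≡0∧im₂≡0⇒≡0 ⟨ a , b ⟩ re≡0 im≡0 with ℤ.i*j≡0⇒i≡0∨j≡0 (+ 2 ℤ.- τ d) im≡0
  ... | inj₁ e    = contradiction e 2-τ≢0
  ... | inj₂ refl with ℤ.i*j≡0⇒i≡0∨j≡0 (+ 2) {a}
        (trans (solve 2 (λ a t → con (+ 2) :* a := con (+ 2) :* a :+ t :* con 0ℤ) refl a (τ d)) re≡0)
  ...   | inj₂ refl = refl

  halfPlane-neg : ∀ z → z ≢ 0# → HalfPlane z ⊎ HalfPlane (- z)
  halfPlane-neg z z≢0 with ℤ.<-cmp 0ℤ (im₂ z)
  ... | tri< 0<im _ _ = inj₁ (inj₁ 0<im)
  ... | tri> _ _ im<0 = inj₂ (inj₁ (subst (0ℤ ℤ.<_) (sym (im₂-neg z)) (ℤ.neg-mono-< im<0)))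
  ... | tri≈ _ 0≡im _ with ℤ.<-cmp 0ℤ (re₂ z)
  ...   | tri< 0<re _ _ = inj₁ (inj₂ (sym 0≡im , 0<re))
  ...   | tri> _ _ re<0 = inj₂ (inj₂ (trans (im₂-neg z) (cong ℤ.-_ (sym 0≡im)) , subst (0ℤ ℤ.<_) (sym (re₂-neg z)) (ℤ.neg-mono-< re<0)))
  ...   | tri≈ _ 0≡re _ = contradiction (re₂≡0∧im₂≡0⇒≡0 z (sym 0≡re) (sym 0≡im)) z≢0

  ¬halfPlane-neg : ∀ z → HalfPlane z → ¬ HalfPlane (- z)
  ¬halfPlane-neg z h h′ = go h (⊎.map (subst (0ℤ ℤ.<_) (im₂-neg z)) (λ (p , q) → trans (sym (im₂-neg z)) p , subst (0ℤ ℤ.<_) (re₂-neg z) q) h′)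
    where
    go : ∀ {x y} → 0ℤ ℤ.< y ⊎ (y ≡ 0ℤ × 0ℤ ℤ.< x) → ¬ (0ℤ ℤ.< ℤ.- y ⊎ (ℤ.- y ≡ 0ℤ × 0ℤ ℤ.< ℤ.- x))
    go (inj₁ 0<y)        (inj₁ 0<-y)       = ℤ.<-asym 0<-y (ℤ.neg-mono-< 0<y)
    go (inj₁ 0<y)        (inj₂ (-y≡0 , _)) = ℤ.<⇒≢ (ℤ.neg-mono-< 0<y) -y≡0
    go (inj₂ (refl , _)) (inj₁ 0<-y)       = ℤ.<-irrefl refl 0<-y
    go (inj₂ (_ , 0<x))  (inj₂ (_ , 0<-x)) = ℤ.<-asym 0<-x (ℤ.neg-mono-< 0<x)

-- `InSector d` unfolds to the half plane only for a concrete `d`, so the equality is passed in;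
-- each instance proves it by reflexivity.
halfPlane : ∀ d → (∀ (z : 𝒪 d) → InSector d z ≡ HalfPlane z) →
  All (λ u → norm u ≡ 1 → u ∈ 1# {d} ∷ - 1# ∷ []) (box 8) → FundamentalSector d
halfPlane d eq all-units = record
  { units     = 1# ∷ - 1# ∷ []
  ; all-units = all-units
  ; rotate    = λ z z≢0 → ⊎.[ (λ h → 1# , norm-1# {d} , from (*-identityˡ z) h)
                            , (λ h → - 1# , trans (norm-neg {d} 1#) (norm-1# {d}) , from (-1* z) h) ] (halfPlane-neg z z≢0)
  ; rigid     = λ z s → (λ _ → refl) ∷
      (λ s′ → contradiction (subst HalfPlane (-1* z) (to s′)) (¬halfPlane-neg z (to s))) ∷ []
  }
  where
  to : ∀ {z : 𝒪 d} → InSector d z → HalfPlane z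
  to {z} = subst id (eq z)
  from : ∀ {z z′ : 𝒪 d} → z ≡ z′ → HalfPlane z′ → InSector d z
  from {z} {z′} e h = subst id (sym (eq z)) (subst HalfPlane (sym e) h)

module _ {d : ℤ} where

  -- The sector in the cases d = -1 and d = -3.
  Quadrant : 𝒪 d → Set
  Quadrant z = 0ℤ ℤ.< rat z × 0ℤ ℤ.≤ coef z

¬0<-neg : ∀ {i} → 0ℤ ℤ.≤ i → ¬ (0ℤ ℤ.< ℤ.- i)
¬0<-neg 0≤i 0<-i = ℤ.<⇒≱ 0<-i (ℤ.neg-mono-≤ 0≤i)

¬0≤-neg : ∀ {i} → 0ℤ ℤ.< i → ¬ (0ℤ ℤ.≤ ℤ.- i)
¬0≤-neg 0<i 0≤-i = ℤ.<⇒≱ (ℤ.neg-mono-< 0<i) 0≤-i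

gaussian : FundamentalSector -[1+ 0 ]
gaussian = record
  { units     = units
  ; all-units = from-yes (units? units)
  ; rotate    = rotate
  ; rigid     = λ { z@(⟨ a , b ⟩) s → let 0<a , 0≤b = to z s in
      (λ _ → refl) ∷
      exclude ⟨ 0ℤ , 1ℤ ⟩ z (i* a b) (¬0<-neg 0≤b ∘ proj₁) ∷
      exclude (- 1#) z (-1* z) (¬0<-neg (ℤ.<⇒≤ 0<a) ∘ proj₁) ∷
      exclude ⟨ 0ℤ , ℤ.-1ℤ ⟩ z (-i* a b) (¬0≤-neg 0<a ∘ proj₂) ∷ [] }
  }
  where
  units : List (𝒪 -[1+ 0 ])
  units = 1# ∷ ⟨ 0ℤ , 1ℤ ⟩ ∷ ⟨ ℤ.-1ℤ , 0ℤ ⟩ ∷ ⟨ 0ℤ , ℤ.-1ℤ ⟩ ∷ []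
  re : ∀ (z : 𝒪 -[1+ 0 ]) → re₂ z ≡ + 2 ℤ.* rat z
  re z = ℤ.+-identityʳ (+ 2 ℤ.* rat z)
  to : ∀ (z : 𝒪 -[1+ 0 ]) → InSector -[1+ 0 ] z → Quadrant z
  to z (p , q) = ℤ.*-cancelˡ-<-nonNeg (+ 2) (subst (0ℤ ℤ.<_) (re z) p) , ℤ.*-cancelˡ-≤-pos 0ℤ (coef z) (+ 2) q
  exclude : ∀ (u z : 𝒪 -[1+ 0 ]) {z′} → u * z ≡ z′ → ¬ Quadrant z′ → InSector -[1+ 0 ] (u * z) → u ≡ 1#
  exclude u z {z′} e ¬q s = contradiction (to z′ (subst (InSector -[1+ 0 ]) e s)) ¬q
  from : ∀ {z z′ : 𝒪 -[1+ 0 ]} → z ≡ z′ → Quadrant z′ → InSector -[1+ 0 ] z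
  from {z} refl (p , q) = subst (0ℤ ℤ.<_) (sym (re z)) (ℤ.*-monoˡ-<-pos (+ 2) p) , ℤ.*-monoˡ-≤-nonNeg (+ 2) q
  i* : ∀ a b → ⟨ 0ℤ , 1ℤ ⟩ * ⟨ a , b ⟩ ≡ ⟨_,_⟩ { -[1+ 0 ]} (ℤ.- b) a
  i* a b = cong₂ ⟨_,_⟩
    (solve 2 (λ a b → con 0ℤ :* a :+ con ℤ.-1ℤ :* (con 1ℤ :* b) := :- b) refl a b)
    (solve 2 (λ a b → con 0ℤ :* b :+ con 1ℤ :* a :+ con 0ℤ :* (con 1ℤ :* b) := a) refl a b)
  -i* : ∀ a b → ⟨ 0ℤ , ℤ.-1ℤ ⟩ * ⟨ a , b ⟩ ≡ ⟨_,_⟩ { -[1+ 0 ]} b (ℤ.- a)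
  -i* a b = cong₂ ⟨_,_⟩
    (solve 2 (λ a b → con 0ℤ :* a :+ con ℤ.-1ℤ :* (con ℤ.-1ℤ :* b) := b) refl a b)
    (solve 2 (λ a b → con 0ℤ :* b :+ con ℤ.-1ℤ :* a :+ con 0ℤ :* (con ℤ.-1ℤ :* b) := :- a) refl a b)
  rotate : ∀ z → z ≢ 0# → ∃ λ u → norm u ≡ 1 × InSector -[1+ 0 ] (u * z)
  rotate z@(⟨ a , b ⟩) z≢0 with ℤ.<-cmp 0ℤ a | ℤ.<-cmp 0ℤ b
  ... | tri< 0<a _ _  | tri< 0<b _ _  = 1# , refl , from (*-identityˡ z) (0<a , ℤ.<⇒≤ 0<b)
  ... | tri< 0<a _ _  | tri≈ _ 0≡b _  = 1# , refl , from (*-identityˡ z) (0<a , ℤ.≤-reflexive 0≡b)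
  ... | tri< 0<a _ _  | tri> _ _ b<0  = ⟨ 0ℤ , 1ℤ ⟩ , refl , from (i* a b) (ℤ.neg-mono-< b<0 , ℤ.<⇒≤ 0<a)
  ... | tri≈ _ 0≡a _  | tri> _ _ b<0  = ⟨ 0ℤ , 1ℤ ⟩ , refl , from (i* a b) (ℤ.neg-mono-< b<0 , ℤ.≤-reflexive 0≡a)
  ... | tri≈ _ refl _ | tri≈ _ refl _ = contradiction refl z≢0
  ... | tri≈ _ refl _ | tri< 0<b _ _  = ⟨ 0ℤ , ℤ.-1ℤ ⟩ , refl , from (-i* a b) (0<b , ℤ.≤-refl)
  ... | tri> _ _ a<0  | tri< 0<b _ _  = ⟨ 0ℤ , ℤ.-1ℤ ⟩ , refl , from (-i* a b) (0<b , ℤ.neg-mono-≤ (ℤ.<⇒≤ a<0))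
  ... | tri> _ _ a<0  | tri≈ _ refl _ = - 1# , refl , from (-1* z) (ℤ.neg-mono-< a<0 , ℤ.≤-refl)
  ... | tri> _ _ a<0  | tri> _ _ b<0  = - 1# , refl , from (-1* z) (ℤ.neg-mono-< a<0 , ℤ.neg-mono-≤ (ℤ.<⇒≤ b<0))

eisenstein : FundamentalSector -[1+ 2 ]
eisenstein = record
  { units     = units
  ; all-units = from-yes (units? units)
  ; rotate    = rotate
  ; rigid     = λ { z@(⟨ a , b ⟩) s → let 0<a , 0≤b = to z s ; 0<a+b = ℤ.+-mono-<-≤ 0<a 0≤b in
      (λ _ → refl) ∷
      exclude ⟨ 0ℤ , 1ℤ ⟩ z (ω* a b) (¬0<-neg 0≤b ∘ proj₁) ∷
      exclude ⟨ ℤ.-1ℤ , 1ℤ ⟩ z (ω²* a b) (¬0<-neg (ℤ.<⇒≤ 0<a+b) ∘ proj₁) ∷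
      exclude (- 1#) z (-1* z) (¬0<-neg (ℤ.<⇒≤ 0<a) ∘ proj₁) ∷
      exclude ⟨ 0ℤ , ℤ.-1ℤ ⟩ z (-ω* a b) (¬0≤-neg 0<a+b ∘ proj₂) ∷
      exclude ⟨ 1ℤ , ℤ.-1ℤ ⟩ z (-ω²* a b) (¬0≤-neg 0<a ∘ proj₂) ∷ [] }
  }
  where
  units : List (𝒪 -[1+ 2 ])
  -- The powers of `ω`, a primitive sixth root of unity, in order; `ω² = ω - 1`.
  units = 1# ∷ ⟨ 0ℤ , 1ℤ ⟩ ∷ ⟨ ℤ.-1ℤ , 1ℤ ⟩ ∷ ⟨ ℤ.-1ℤ , 0ℤ ⟩ ∷ ⟨ 0ℤ , ℤ.-1ℤ ⟩ ∷ ⟨ 1ℤ , ℤ.-1ℤ ⟩ ∷ []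
  -- With `τ = 1` the condition `im₂ z < re₂ z` reads `b < 2a + b`, that is, `0 < a`.
  to : ∀ (z : 𝒪 -[1+ 2 ]) → InSector -[1+ 2 ] z → Quadrant z
  to z (p , q) = ℤ.*-cancelˡ-<-nonNeg (+ 2) (subst₂ ℤ._<_
      (ℤ.+-inverseʳ (+ 1 ℤ.* coef z))
      (solve 2 (λ a b → con (+ 2) :* a :+ con (+ 1) :* b :- con (+ 1) :* b := con (+ 2) :* a) refl (rat z) (coef z))
      (ℤ.+-monoˡ-< (ℤ.- (+ 1 ℤ.* coef z)) q)) ,
    ℤ.*-cancelˡ-≤-pos 0ℤ (coef z) (+ 1) p
  exclude : ∀ (u z : 𝒪 -[1+ 2 ]) {z′} → u * z ≡ z′ → ¬ Quadrant z′ → InSector -[1+ 2 ] (u * z) → u ≡ 1#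
  exclude u z {z′} e ¬q s = contradiction (to z′ (subst (InSector -[1+ 2 ]) e s)) ¬q
  from : ∀ {z z′ : 𝒪 -[1+ 2 ]} → z ≡ z′ → Quadrant z′ → InSector -[1+ 2 ] z
  from {z} refl (p , q) = ℤ.*-monoˡ-≤-nonNeg (+ 1) q ,
    subst (ℤ._< re₂ z) (ℤ.+-identityˡ (+ 1 ℤ.* coef z)) (ℤ.+-monoˡ-< (+ 1 ℤ.* coef z) (ℤ.*-monoˡ-<-pos (+ 2) p))
  ω* : ∀ a b → ⟨ 0ℤ , 1ℤ ⟩ * ⟨ a , b ⟩ ≡ ⟨_,_⟩ { -[1+ 2 ]} (ℤ.- b) (a ℤ.+ b)
  ω* a b = cong₂ ⟨_,_⟩
    (solve 2 (λ a b → con 0ℤ :* a :+ con ℤ.-1ℤ :* (con 1ℤ :* b) := :- b) refl a b)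
    (solve 2 (λ a b → con 0ℤ :* b :+ con 1ℤ :* a :+ con 1ℤ :* (con 1ℤ :* b) := a :+ b) refl a b)
  ω²* : ∀ a b → ⟨ ℤ.-1ℤ , 1ℤ ⟩ * ⟨ a , b ⟩ ≡ ⟨_,_⟩ { -[1+ 2 ]} (ℤ.- (a ℤ.+ b)) a
  ω²* a b = cong₂ ⟨_,_⟩
    (solve 2 (λ a b → con ℤ.-1ℤ :* a :+ con ℤ.-1ℤ :* (con 1ℤ :* b) := :- (a :+ b)) refl a b)
    (solve 2 (λ a b → con ℤ.-1ℤ :* b :+ con 1ℤ :* a :+ con 1ℤ :* (con 1ℤ :* b) := a) refl a b)
  -ω* : ∀ a b → ⟨ 0ℤ , ℤ.-1ℤ ⟩ * ⟨ a , b ⟩ ≡ ⟨_,_⟩ { -[1+ 2 ]} b (ℤ.- (a ℤ.+ b))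
  -ω* a b = cong₂ ⟨_,_⟩
    (solve 2 (λ a b → con 0ℤ :* a :+ con ℤ.-1ℤ :* (con ℤ.-1ℤ :* b) := b) refl a b)
    (solve 2 (λ a b → con 0ℤ :* b :+ con ℤ.-1ℤ :* a :+ con 1ℤ :* (con ℤ.-1ℤ :* b) := :- (a :+ b)) refl a b)
  -ω²* : ∀ a b → ⟨ 1ℤ , ℤ.-1ℤ ⟩ * ⟨ a , b ⟩ ≡ ⟨_,_⟩ { -[1+ 2 ]} (a ℤ.+ b) (ℤ.- a)
  -ω²* a b = cong₂ ⟨_,_⟩
    (solve 2 (λ a b → con 1ℤ :* a :+ con ℤ.-1ℤ :* (con ℤ.-1ℤ :* b) := a :+ b) refl a b)
    (solve 2 (λ a b → con 1ℤ :* b :+ con ℤ.-1ℤ :* a :+ con 1ℤ :* (con ℤ.-1ℤ :* b) := :- a) refl a b)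
  rotate : ∀ z → z ≢ 0# → ∃ λ u → norm u ≡ 1 × InSector -[1+ 2 ] (u * z)
  rotate z@(⟨ a , b ⟩) z≢0 with ℤ.<-cmp 0ℤ a | ℤ.<-cmp 0ℤ b
  ... | tri< 0<a _ _  | tri< 0<b _ _  = 1# , refl , from (*-identityˡ z) (0<a , ℤ.<⇒≤ 0<b)
  ... | tri< 0<a _ _  | tri≈ _ 0≡b _  = 1# , refl , from (*-identityˡ z) (0<a , ℤ.≤-reflexive 0≡b)
  ... | tri≈ _ refl _ | tri≈ _ refl _ = contradiction refl z≢0
  ... | tri≈ _ refl _ | tri> _ _ b<0  = ⟨ ℤ.-1ℤ , 1ℤ ⟩ , refl ,
    from (ω²* a b) (subst (λ i → 0ℤ ℤ.< ℤ.- i) (sym (ℤ.+-identityˡ b)) (ℤ.neg-mono-< b<0) , ℤ.≤-refl)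
  ... | tri> _ _ a<0  | tri≈ _ refl _ = - 1# , refl , from (-1* z) (ℤ.neg-mono-< a<0 , ℤ.≤-refl)
  ... | tri> _ _ a<0  | tri> _ _ b<0  = - 1# , refl , from (-1* z) (ℤ.neg-mono-< a<0 , ℤ.neg-mono-≤ (ℤ.<⇒≤ b<0))
  ... | tri≈ _ refl _ | tri< 0<b _ _  = ⟨ 1ℤ , ℤ.-1ℤ ⟩ , refl ,
    from (-ω²* a b) (subst (0ℤ ℤ.<_) (sym (ℤ.+-identityˡ b)) 0<b , ℤ.≤-refl)
  -- In the basis `1`, `ω` the region of opposite signs spans 120 degrees, two sectors; the sign of
  -- `a + b` tells them apart.
  ... | tri< 0<a _ _  | tri> _ _ b<0  with 0ℤ ℤ.≤? a ℤ.+ b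
  ...   | yes 0≤a+b = ⟨ 0ℤ , 1ℤ ⟩ , refl , from (ω* a b) (ℤ.neg-mono-< b<0 , 0≤a+b)
  ...   | no  0≰a+b = ⟨ ℤ.-1ℤ , 1ℤ ⟩ , refl , from (ω²* a b) (ℤ.neg-mono-< (ℤ.≰⇒> 0≰a+b) , ℤ.<⇒≤ 0<a)
  rotate z@(⟨ a , b ⟩) z≢0 | tri> _ _ a<0 | tri< 0<b _ _ with 0ℤ ℤ.<? a ℤ.+ b
  ...   | yes 0<a+b = ⟨ 1ℤ , ℤ.-1ℤ ⟩ , refl , from (-ω²* a b) (0<a+b , ℤ.neg-mono-≤ (ℤ.<⇒≤ a<0))
  ...   | no  0≮a+b = ⟨ 0ℤ , ℤ.-1ℤ ⟩ , refl , from (-ω* a b) (0<b , ℤ.neg-mono-≤ (ℤ.≮⇒≥ 0≮a+b))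

fundamentalSector : ∀ {d} → d ∈ ds → FundamentalSector d
fundamentalSector = All.lookup {P = FundamentalSector} (
  halfPlane -[1+ 162 ] (λ _ → refl) (from-yes (units? { -[1+ 162 ]} (1# ∷ - 1# ∷ []))) ∷
  halfPlane -[1+ 66 ] (λ _ → refl) (from-yes (units? { -[1+ 66 ]} (1# ∷ - 1# ∷ []))) ∷
  halfPlane -[1+ 42 ] (λ _ → refl) (from-yes (units? { -[1+ 42 ]} (1# ∷ - 1# ∷ []))) ∷
  halfPlane -[1+ 18 ] (λ _ → refl) (from-yes (units? { -[1+ 18 ]} (1# ∷ - 1# ∷ []))) ∷
  halfPlane -[1+ 10 ] (λ _ → refl) (from-yes (units? { -[1+ 10 ]} (1# ∷ - 1# ∷ []))) ∷
  halfPlane -[1+ 6 ] (λ _ → refl) (from-yes (units? { -[1+ 6 ]} (1# ∷ - 1# ∷ []))) ∷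
  eisenstein ∷
  halfPlane -[1+ 1 ] (λ _ → refl) (from-yes (units? { -[1+ 1 ]} (1# ∷ - 1# ∷ []))) ∷
  gaussian ∷ [])

-- Sums over unitary divisors

square-injective : ∀ {m n} → m ℕ.* m ≡ n ℕ.* n → m ≡ n
square-injective {m} {n} eq with ℕ.<-cmp m n
... | tri< m<n _ _ = contradiction eq (ℕ.<⇒≢ (ℕ.*-mono-< m<n m<n))
... | tri≈ _ m≡n _ = m≡n
... | tri> _ _ n<m = contradiction (sym eq) (ℕ.<⇒≢ (ℕ.*-mono-< n<m n<m))

isqrt-bounds : ∀ n → Real.isqrt n ℕ.* Real.isqrt n ℕ.≤ n × n ℕ.< suc (Real.isqrt n) ℕ.* suc (Real.isqrt n)
isqrt-bounds zero = ℕ.z≤n , ℕ.s≤s ℕ.z≤n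
isqrt-bounds (suc n) with isqrt-bounds n | suc (Real.isqrt n) ℕ.* suc (Real.isqrt n) ℕ.≤? suc n
... | _  , hi | yes h = h , ℕ.≤-<-trans hi (ℕ.*-mono-< (ℕ.n<1+n (suc (Real.isqrt n))) (ℕ.n<1+n (suc (Real.isqrt n))))
... | lo , _  | no  h = ℕ.m≤n⇒m≤1+n lo , ℕ.≰⇒> h

isqrt-square : ∀ m → Real.isqrt (m ℕ.* m) ≡ m
isqrt-square m = ℕ.≤-antisym
  (ℕ.≮⇒≥ λ m<s → ℕ.<⇒≱ (ℕ.*-mono-< m<s m<s) (proj₁ (isqrt-bounds (m ℕ.* m))))
  (ℕ.≮⇒≥ λ s<m → ℕ.<⇒≱ (proj₂ (isqrt-bounds (m ℕ.* m))) (ℕ.*-mono-≤ s<m s<m))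

-- The radicand `c² (k+1)²` is a perfect square, so every approximation is exact. Identities between
-- the reals involved can thus be proved term by term in `ℚ`.
√-seq-square : ∀ c k → Real.√-seq (c ℕ.* c) k ≡ fromℕ c
√-seq-square c k = trans
  (cong (λ m → + m ℚ./ suc k) (trans (cong Real.isqrt (ℕ.[m*n]*[o*p]≡[m*o]*[n*p] c c (suc k) (suc k))) (isqrt-square (c ℕ.* suc k))))
  (ℚ.fromℚᵘ-cong {ℚᵘ.mkℚᵘ (+ (c ℕ.* suc k)) k} {ℚᵘ.mkℚᵘ (+ c) 0}
    (ℚᵘ.*≡* (trans (ℤ.*-identityʳ (+ (c ℕ.* suc k))) (ℤ.pos-* c (suc k)))))

fromℕ-+ : ∀ m n → fromℕ (m ℕ.+ n) ≡ fromℕ m ℚ.+ fromℕ n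
fromℕ-+ m n = ℚ.toℚᵘ-injective (ℚᵘ.≃-trans (ℚ.toℚᵘ-fromℚᵘ (ℚᵘ.mkℚᵘ (+ (m ℕ.+ n)) 0)) (ℚᵘ.≃-trans
  (ℚᵘ.*≡* (cong (ℤ._* 1ℤ) (sym (cong₂ ℤ._+_ (ℤ.*-identityʳ (+ m)) (ℤ.*-identityʳ (+ n))))))
  (ℚᵘ.≃-sym (ℚᵘ.≃-trans (ℚ.toℚᵘ-homo-+ (fromℕ m) (fromℕ n))
    (ℚᵘ.+-cong (ℚ.toℚᵘ-fromℚᵘ (ℚᵘ.mkℚᵘ (+ m) 0)) (ℚ.toℚᵘ-fromℚᵘ (ℚᵘ.mkℚᵘ (+ n) 0)))))))

fromℕ-*-inv₀ : ∀ {n} → 0 ℕ.< n → fromℕ n ℚ.* Real.inv₀ (fromℕ n) ≡ 1ℚ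
fromℕ-*-inv₀ {suc n} _ with fromℕ (suc n) ℚ.≟ 0ℚ
... | yes e = contradiction (sym e) (ℚ.<⇒≢ (ℚ.positive⁻¹ (fromℕ (suc n)) {{ℚ.normalize-pos (suc n) 1}}))
... | no  e = ℚ.*-inverseʳ (fromℕ (suc n)) {{ℚ.≢-nonZero e}}

sumℚ : List ℚ → ℚ
sumℚ = foldr ℚ._+_ 0ℚ

unitary? : ∀ n k → Dec (suc k ℕ.∣ n × ℕ.gcd (suc k) (n ℕ./ suc k) ≡ 1)
unitary? n k = (suc k ℕ.∣? n) ×-dec (ℕ.gcd (suc k) (n ℕ./ suc k) ℕ.≟ 1)

unitaryDivisorsℕ : ℕ → List ℕ
unitaryDivisorsℕ n = map suc (filter (unitary? n) (upTo n))

unitaryDivisorsℕ-unique : ∀ n → Unique (unitaryDivisorsℕ n)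
unitaryDivisorsℕ-unique n = Unique.map⁺ ℕ.suc-injective (Unique.filter⁺ (unitary? n) (Unique.upTo⁺ n))

∈-unitaryDivisorsℕ⁻ : ∀ {c n} → c ∈ unitaryDivisorsℕ n → 0 ℕ.< c × ∃ λ c′ → c ℕ.* c′ ≡ n × ℕ.Coprime c c′
∈-unitaryDivisorsℕ⁻ {c} {n} p with ∈.∈-map⁻ suc p
... | k , q , refl with ∈.∈-filter⁻ (unitary? n) {xs = upTo n} q
...   | _ , ℕ.divides c′ refl , gcd≡1 = ℕ.s≤s ℕ.z≤n , c′ , ℕ.*-comm (suc k) c′ ,
  subst (ℕ.Coprime (suc k)) (ℕ.m*n/n≡m c′ (suc k)) (ℕ.gcd≡1⇒coprime gcd≡1)

∈-unitaryDivisorsℕ⁺ : ∀ {c c′ n} → 0 ℕ.< n → c ℕ.* c′ ≡ n → ℕ.Coprime c c′ → c ∈ unitaryDivisorsℕ n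
∈-unitaryDivisorsℕ⁺ {suc k} {zero}  0<n refl _ = contradiction (ℕ.*-zeroʳ (suc k)) (ℕ.<⇒≢ 0<n ∘ sym)
∈-unitaryDivisorsℕ⁺ {suc k} {c′@(suc _)} _ refl c = ∈.∈-map⁺ suc (∈.∈-filter⁺ (unitary? (suc k ℕ.* c′))
  (∈.∈-upTo⁺ (ℕ.m≤m*n (suc k) c′))
  (ℕ.m∣m*n c′ , trans (cong (ℕ.gcd (suc k)) (trans (cong (ℕ._/ suc k) (ℕ.*-comm (suc k) c′)) (ℕ.m*n/n≡m c′ (suc k)))) (ℕ.coprime⇒gcd≡1 c)))

module _ {d : ℤ} (d∈ds : d ∈ ds) where

  private
    d<0 = ds<0 d∈ds
    classOne = classNumberOne d∈ds
  open FundamentalSector (fundamentalSector d∈ds) using (representative; representative-unique)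

  embedding : ∀ n → ∃ λ z → z ∥ lift d<0 classOne n × (0 ℕ.< n → A d z)
  -- Zero is included so that `embed` is total and has norm `n²` everywhere; membership in `A d` is
  -- claimed for positive `n` only.
  embedding zero      = 0# , ≡⇒∥ refl , λ ()
  embedding n@(suc _) =
    let z , z∈A , z∥ = representative d<0 (lift d<0 classOne n) (lift≢0 d<0 classOne {n} (ℕ.s≤s ℕ.z≤n))
    in z , z∥ , λ _ → z∈A

  embed : ℕ → 𝒪 d
  embed n = proj₁ (embedding n)

  embed-∥ : ∀ n → embed n ∥ lift d<0 classOne n
  embed-∥ n = proj₁ (proj₂ (embedding n))

  embed-A : ∀ {n} → 0 ℕ.< n → A d (embed n)
  embed-A {n} = proj₂ (proj₂ (embedding n))

  norm-embed : ∀ n → norm (embed n) ≡ n ℕ.* n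
  norm-embed n = trans (norm-cong-∥ (embed-∥ n)) (norm-lift d<0 classOne n)

  embed-injective : ∀ {m n} → embed m ≡ embed n → m ≡ n
  embed-injective {m} {n} eq = square-injective (trans (sym (norm-embed m)) (trans (cong norm eq) (norm-embed n)))

  module _ {n : ℕ} (0<n : 0 ℕ.< n) where

    -- Two lists without repetitions and with the same members are permutations of each other. A
    -- unitary divisor `x` is associate to some `lift c`, as is `embed c`; both lie in `A d`, so
    -- they coincide.
    unitaryDivisors-embed : unitaryDivisors d<0 (embed n) ↭ map embed (unitaryDivisorsℕ n)
    unitaryDivisors-embed = ∼bag⇒↭ (unique∧set⇒bag (unitaryDivisors-unique d<0 (embed n))
      (Unique.map⁺ embed-injective (unitaryDivisorsℕ-unique n)) (mk⇔ to from))
      where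
      z≢0 = proj₁ (embed-A 0<n)
      to : ∀ {x} → x ∈ unitaryDivisors d<0 (embed n) → x ∈ map embed (unitaryDivisorsℕ n)
      to {x} x∈ =
        let x∈A , y , yx≡z , coprime = Equivalence.to (∈-unitaryDivisors d<0 z≢0) x∈
            c , c′ , cc′≡n , c⊥c′ , x∥ = unitary-factor d<0 classOne 0<n (embed-∥ n) {x} {y} yx≡z coprime
            c∈ = ∈-unitaryDivisorsℕ⁺ 0<n cc′≡n c⊥c′
        in subst (_∈ map embed (unitaryDivisorsℕ n))
             (sym (representative-unique d<0 x∈A (embed-A (proj₁ (∈-unitaryDivisorsℕ⁻ {n = n} c∈))) (∥-trans x∥ (∥-sym (embed-∥ c)))))
             (∈.∈-map⁺ embed c∈)
      from : ∀ {x} → x ∈ map embed (unitaryDivisorsℕ n) → x ∈ unitaryDivisors d<0 (embed n)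
      from x∈ =
        let c , c∈ , x≡ = ∈.∈-map⁻ embed x∈
            0<c , c′ , cc′≡n , c⊥c′ = ∈-unitaryDivisorsℕ⁻ {n = n} c∈
        in subst (_∈ unitaryDivisors d<0 (embed n)) (sym x≡) (Equivalence.from (∈-unitaryDivisors d<0 z≢0)
             (embed-A 0<c , unitary-factor⁻¹ d<0 classOne 0<n (embed-∥ n) cc′≡n c⊥c′ (embed-∥ c)))

    -- After the permutation each summand is the modulus of some `embed c`, of norm `c²`, so its
    -- approximations all equal `c` and the sum is exact at every index.
    seq-δ₁* : ∀ k → Real.seq (δ₁* d<0 (embed n)) k ≡ fromℕ (σ* n)
    seq-δ₁* k = trans (seq-sum (unitaryDivisors d<0 (embed n))) (trans
      (↭ₛ.foldr-commMonoid (setoid ℚ) ℚ.+-0-isCommutativeMonoid (↭⇒↭ₛ (↭.map⁺ (λ z → Real.√-seq (norm z) k) unitaryDivisors-embed)))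
      (sum-embed (unitaryDivisorsℕ n)))
      where
      seq-sum : ∀ zs → Real.seq (foldr _⊕_ 0ℝ (map modulus zs)) k ≡ sumℚ (map (λ z → Real.√-seq (norm {d} z) k) zs)
      seq-sum []       = refl
      seq-sum (z ∷ zs) = cong (Real.√-seq (norm z) k ℚ.+_) (seq-sum zs)
      sum-embed : ∀ cs → sumℚ (map (λ z → Real.√-seq (norm z) k) (map embed cs)) ≡ fromℕ (sum cs)
      sum-embed []       = refl
      sum-embed (c ∷ cs) = trans (cong₂ ℚ._+_ (trans (cong (λ m → Real.√-seq m k) (norm-embed c)) (√-seq-square c k)) (sum-embed cs))
        (sym (fromℕ-+ c (sum cs)))

    I₁*-embed : ∀ {b} → fromℕ (σ* n) ≡ b ℚ.* fromℕ n → I₁* d<0 (embed n) (proj₁ (embed-A 0<n)) ≃ fromℚ b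
    I₁*-embed {b} eq ε 0<ε = 0 , λ k _ → subst (λ q → ℚ.∣ q ℚ.- b ∣ < ε) (sym (seq≡b k))
      (subst (_< ε) (sym (cong ℚ.∣_∣ (ℚ.+-inverseʳ b))) 0<ε)
      where
      seq≡b : ∀ k → Real.seq (I₁* d<0 (embed n) (proj₁ (embed-A 0<n))) k ≡ b
      seq≡b k = begin
        Real.seq (δ₁* d<0 (embed n)) k ℚ.* Real.inv₀ (Real.√-seq (norm (embed n)) k)
          ≡⟨ cong₂ (λ p q → p ℚ.* Real.inv₀ q) (trans (seq-δ₁* k) eq)
               (trans (cong (λ m → Real.√-seq m k) (norm-embed n)) (√-seq-square n k)) ⟩
        b ℚ.* fromℕ n ℚ.* Real.inv₀ (fromℕ n)     ≡⟨ ℚ.*-assoc b (fromℕ n) _ ⟩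
        b ℚ.* (fromℕ n ℚ.* Real.inv₀ (fromℕ n))   ≡⟨ cong (b ℚ.*_) (fromℕ-*-inv₀ 0<n) ⟩
        b ℚ.* 1ℚ                                  ≡⟨ ℚ.*-identityʳ b ⟩
        b                                         ∎

theorem2p6 : (b : ℚ) → 1ℚ < b → (d : ℤ) (d∈ds : d ∈ ds) →
    ∃ λ (g : U b → V (ds<0 d∈ds) b) → Injective _≡_ _≡_ g
theorem2p6 b _ d d∈ds = Refinement.map (embed d∈ds) (λ (0<n , eq) → embed-A d∈ds 0<n , I₁*-embed d∈ds 0<n eq) ,
  λ {m} {n} eq → refinement-≡ (embed-injective d∈ds (cong Refinement.value eq))
  where
  refinement-≡ : ∀ {m n : U b} → Refinement.value m ≡ Refinement.value n → m ≡ n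
  refinement-≡ refl = refl
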